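{- Let $G=G(n,1/2)$ be the binomial random graph on $n$ vertices. Then with probability tending to $1$ as $n\to\infty$, $HG(G)\ge n^{1-o(1)}$.
   Context: $G(n,1/2)$ is the random graph on $n$ labeled vertices in which each pair of vertices is joined by an edge independently with probability $1/2$. The hat guessing game on a finite simple graph $G$ with $q$ colors: each vertex (player) is assigned a hat whose color is an arbitrary element of a fixed set $Q$ of $q$ colors. Each player sees the hat colors of exactly its neighbors in $G$ (not its own). Before the colors are assigned, the players fix a deterministic guessing strategy: for each vertex $w$, a function from the colorings of the neighbors of $w$ to $Q$, which is $w$'s guess for its own color. No communication is allowed. The strategy is winning if for every assignment of colors from $Q$ to all vertices, at least one vertex guesses its own color correctly. The hat guessing number $HG(G)$ is the largest integer $q$ for which a winning strategy with $q$ colors exists. -}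

module Defs where

open import Data.Bool.Base using (Bool; true; false; T; if_then_else_)
open import Data.Bool.Properties using (T?)
open import Data.Fin.Base using (Fin; zero; suc)
import Data.Fin.Properties as Fin
open import Data.Integer.Base using (+_; -[1+_])
open import Data.List.Base using (List; allFin; filter; length)
open import Data.List.Membership.Propositional using (_∈_)
open import Data.List.Membership.Propositional.Properties using (∈-filter⁻)
open import Data.List.Relation.Unary.Any using (here; there)
open import Data.Nat.Base
  using (ℕ; zero; suc; _+_; _*_; _^_; _≤_; _<_; z≤n; s≤s; NonZero)
import Data.Nat.Properties as ℕ
open import Data.Product.Base using (Σ; ∃; ∃-syntax; _×_; _,_)
open import Data.Rational.Base as ℚ using (ℚ; 0ℚ; 1ℚ)
open import Data.Vec.Base using (Vec; []; _∷_; lookup; map; fromList; _[_]≔_)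
open import Data.Vec.Properties using (lookup∘update; lookup∘update′)
open import Function.Base using (_∘_)
open import Relation.Binary.PropositionalEquality
  using (_≡_; _≢_; refl; sym; trans; cong; cong₂; subst)
open import Relation.Nullary.Decidable
  using (Dec; yes; no; does; map′; dec-true)
open import Relation.Nullary.Negation using (contradiction)
open import Relation.Unary using (Pred; Decidable)
open import Level using (0ℓ)
open import Algebra.Properties.CommutativeMonoid.Sum ℕ.+-0-commutativeMonoid
  using (sum; sum-cong-≗; ∑-comm)

------------------------------------------------------------------------
-- Finite simple graphs on the vertex set Fin n

record Graph (n : ℕ) : Set where
  field
    adj         : Fin n → Fin n → Bool
    symmetric   : ∀ v w → adj v w ≡ adj w v
    irreflexive : ∀ v → adj v v ≡ false

  neighbours : Fin n → List (Fin n)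
  neighbours w = filter (λ v → T? (adj w v)) (allFin n)

  degree : Fin n → ℕ
  degree w = length (neighbours w)

open Graph

------------------------------------------------------------------------
-- The hat guessing game

Colouring : ℕ → ℕ → Set
Colouring q n = Vec (Fin q) n

-- What w sees: the colours of its neighbours, listed in the increasing order
-- of the neighbours.
view : ∀ {n q} (G : Graph n) → Colouring q n → ∀ w → Vec (Fin q) (degree G w)
view G c w = map (lookup c) (fromList (neighbours G w))

Strategy : ∀ {n} → Graph n → ℕ → Set
Strategy G q = ∀ w → Vec (Fin q) (degree G w) → Fin q

Winning : ∀ {n q} (G : Graph n) → Strategy G q → Set
Winning {q = q} G s = ∀ (c : Colouring q _) → ∃[ w ] s w (view G c w) ≡ lookup c w

Winnable : ∀ {n} → Graph n → ℕ → Set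
Winnable G q = Σ (Strategy G q) (Winning G)

IsHatGuessingNumber : ∀ {n} → Graph n → ℕ → Set
IsHatGuessingNumber G h = Winnable G h × (∀ q → Winnable G q → q ≤ h)

------------------------------------------------------------------------
-- Winnability is decidable

-- A can be searched for witnesses of decidable predicates respecting _≈_.
Searchable : (A : Set) → (A → A → Set) → Set₁
Searchable A _≈_ =
  ∀ (P : A → Set) → (∀ a b → a ≈ b → P a → P b) → Decidable P → Dec (∃ P)

search-Fin : ∀ q → Searchable (Fin q) _≡_
search-Fin q P resp P? = Fin.any? P?

search-Π : ∀ n (A : Fin n → Set) (R : ∀ i → A i → A i → Set) →
           (∀ i a → R i a a) → (∀ i → Searchable (A i) (R i)) →
           Searchable (∀ i → A i) (λ f g → ∀ i → R i (f i) (g i))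
search-Π zero A R rfl sA P resp P? =
  map′ (λ p → nil , p) (λ { (f , p) → resp f nil (λ ()) p }) (P? nil)
  where
  nil : ∀ i → A i
  nil ()
search-Π (suc n) A R rfl sA P resp P? =
  map′ (λ { (a , f , p) → cons a f , p })
       (λ { (f , p) → f zero , f ∘ suc
                    , resp f (cons (f zero) (f ∘ suc))
                        (λ { zero → rfl _ _ ; (suc i) → rfl _ _ }) p })
       (sA zero (λ a → ∃ λ f → P (cons a f))
          (λ { a b a≈b (f , p) → f , resp (cons a f) (cons b f)
                                       (λ { zero → a≈b ; (suc i) → rfl _ _ }) p })
          (λ a → search-Π n (A ∘ suc) (λ i → R (suc i)) (λ i → rfl (suc i))
                   (λ i → sA (suc i)) (λ f → P (cons a f))
                   (λ f g f≈g → resp (cons a f) (cons a g)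
                                  (λ { zero → rfl _ _ ; (suc i) → f≈g i }))
                   (λ f → P? (cons a f))))
  where
  cons : A zero → (∀ i → A (suc i)) → ∀ i → A i
  cons a f zero    = a
  cons a f (suc i) = f i

search-Guess : ∀ q d → Searchable (Vec (Fin q) d → Fin q) (λ f g → ∀ v → f v ≡ g v)
search-Guess q zero P resp P? =
  map′ (λ { (a , p) → (λ _ → a) , p })
       (λ { (f , p) → f [] , resp f (λ _ → f []) (λ { [] → refl }) p })
       (search-Fin q (λ a → P (λ _ → a)) (λ { a .a refl p → p }) (λ a → P? (λ _ → a)))
search-Guess q (suc d) P resp P? =
  map′ (λ { (f , p) → uncurry f , p })
       (λ { (f , p) → (λ x v → f (x ∷ v)) , resp f _ (λ { (x ∷ v) → refl }) p })
       (search-Π q (λ _ → Vec (Fin q) d → Fin q) (λ _ f g → ∀ v → f v ≡ g v)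
          (λ _ _ _ → refl) (λ _ → search-Guess q d) (λ f → P (uncurry f))
          (λ f g f≈g → resp (uncurry f) (uncurry g) (λ { (x ∷ v) → f≈g x v }))
          (λ f → P? (uncurry f)))
  where
  uncurry : (Fin q → Vec (Fin q) d → Fin q) → Vec (Fin q) (suc d) → Fin q
  uncurry f (x ∷ v) = f x v

allColourings? : ∀ {q n} {P : Colouring q n → Set} → Decidable P → Dec (∀ c → P c)
allColourings? {n = zero}  P? = map′ (λ { p [] → p }) (λ p → p []) (P? [])
allColourings? {n = suc n} P? =
  map′ (λ { p (x ∷ c) → p x c }) (λ p x c → p (x ∷ c))
       (Fin.all? (λ x → allColourings? (λ c → P? (x ∷ c))))

winnable? : ∀ {n} (G : Graph n) → Decidable (Winnable G)
winnable? G q =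
  search-Π _ _ (λ _ f g → ∀ v → f v ≡ g v) (λ _ _ _ → refl)
    (λ w → search-Guess q (degree G w)) (Winning G)
    (λ s t s≈t win c → let (w , eq) = win c in w , trans (sym (s≈t w _)) eq)
    (λ s → allColourings? (λ c → Fin.any? (λ w → s w (view G c w) Fin.≟ lookup c w)))

------------------------------------------------------------------------
-- Winnable G q implies q ≤ n: each player guesses correctly on a fraction
-- 1/q of the colourings.

sum-mono : ∀ {m} (f g : Fin m → ℕ) → (∀ i → f i ≤ g i) → sum f ≤ sum g
sum-mono {zero}  f g f≤g = z≤n
sum-mono {suc m} f g f≤g =
  ℕ.+-mono-≤ (f≤g zero) (sum-mono (f ∘ suc) (g ∘ suc) (f≤g ∘ suc))

sum-const : ∀ m k → sum {m} (λ _ → k) ≡ m * k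
sum-const zero    k = refl
sum-const (suc m) k = cong (_+_ k) (sum-const m k)

sum-* : ∀ {m} k (f : Fin m → ℕ) → sum (λ i → k * f i) ≡ k * sum f
sum-* {zero}  k f = sym (ℕ.*-zeroʳ k)
sum-* {suc m} k f = trans (cong (_+_ (k * f zero)) (sum-* k (f ∘ suc)))
                          (sym (ℕ.*-distribˡ-+ k (f zero) (sum (f ∘ suc))))

term≤sum : ∀ {m} (f : Fin m → ℕ) i → f i ≤ sum f
term≤sum f zero    = ℕ.m≤m+n _ _
term≤sum f (suc i) = ℕ.≤-trans (term≤sum (f ∘ suc) i) (ℕ.m≤n+m _ _)

indicator : ∀ {P : Set} → Dec P → ℕ
indicator P? = if does P? then 1 else 0

sum-indicator : ∀ {m} (k : Fin m) → sum (λ x → indicator (k Fin.≟ x)) ≡ 1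
sum-indicator {suc m} zero    =
  cong suc (trans (sum-const m 0) (ℕ.*-zeroʳ m))
sum-indicator {suc m} (suc k) = sum-indicator k

ΣC : ∀ {q n} → (Colouring q n → ℕ) → ℕ
ΣC {n = zero}  f = f []
ΣC {n = suc n} f = sum (λ x → ΣC (λ c → f (x ∷ c)))

ΣC-cong : ∀ {q n} (f g : Colouring q n → ℕ) → (∀ c → f c ≡ g c) → ΣC f ≡ ΣC g
ΣC-cong {n = zero}  f g f≡g = f≡g []
ΣC-cong {n = suc n} f g f≡g =
  sum-cong-≗ (λ x → ΣC-cong (f ∘ (x ∷_)) (g ∘ (x ∷_)) (λ c → f≡g (x ∷ c)))

ΣC-mono : ∀ {q n} (f g : Colouring q n → ℕ) → (∀ c → f c ≤ g c) → ΣC f ≤ ΣC g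
ΣC-mono {n = zero}  f g f≤g = f≤g []
ΣC-mono {n = suc n} f g f≤g =
  sum-mono _ _ (λ x → ΣC-mono (f ∘ (x ∷_)) (g ∘ (x ∷_)) (λ c → f≤g (x ∷ c)))

ΣC-one : ∀ q n → ΣC {q} {n} (λ _ → 1) ≡ q ^ n
ΣC-one q zero    = refl
ΣC-one q (suc n) = trans (sum-cong-≗ {q} (λ _ → ΣC-one q n)) (sum-const q (q ^ n))

ΣC-sum : ∀ {q n m} (f : Fin m → Colouring q n → ℕ) →
         ΣC (λ c → sum (λ i → f i c)) ≡ sum (λ i → ΣC (f i))
ΣC-sum {n = zero}  f = refl
ΣC-sum {n = suc n} f =
  trans (sum-cong-≗ (λ x → ΣC-sum (λ i c → f i (x ∷ c))))
        (∑-comm (λ x i → ΣC (λ c → f i (x ∷ c))))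

ΣC-recolour : ∀ {q n} (w : Fin n) (f : Colouring q n → ℕ) →
              ΣC (λ c → sum (λ x → f (c [ w ]≔ x))) ≡ q * ΣC f
ΣC-recolour {q} zero f =
  trans (sum-const q _) (cong (q *_) (ΣC-sum (λ x c → f (x ∷ c))))
ΣC-recolour {q} (suc w) f =
  trans (sum-cong-≗ (λ y → ΣC-recolour w (λ c → f (y ∷ c))))
        (sum-* q (λ y → ΣC (λ c → f (y ∷ c))))

map-update : ∀ {n q} (c : Colouring q n) w x (vs : List (Fin n)) →
             (∀ {v} → v ∈ vs → v ≢ w) →
             map (lookup (c [ w ]≔ x)) (fromList vs) ≡ map (lookup c) (fromList vs)
map-update c w x List.[]         v≢w = refl
map-update c w x (v List.∷ vs) v≢w =
  cong₂ _∷_ (lookup∘update′ (v≢w (here refl)) c x)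
            (map-update c w x vs (v≢w ∘ there))

view-update : ∀ {n q} (G : Graph n) (c : Colouring q n) w x →
              view G (c [ w ]≔ x) w ≡ view G c w
view-update {n} G c w x = map-update c w x (neighbours G w) v≢w
  where
  v≢w : ∀ {v} → v ∈ neighbours G w → v ≢ w
  v≢w v∈ refl with ∈-filter⁻ (λ v → T? (adj G w v)) {xs = allFin n} v∈
  ... | _ , adjacent = subst T (irreflexive G w) adjacent

winnable⇒≤ : ∀ {n} (G : Graph n) q → Winnable G q → q ≤ n
winnable⇒≤ {n} G zero win = z≤n
winnable⇒≤ {n} G q@(suc _) (s , win) =
  ℕ.*-cancelʳ-≤ q n (q ^ n) {{ℕ.m^n≢0 q n}} (begin
    q * q ^ n                              ≡⟨ cong (q *_) (ΣC-one q n) ⟨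
    q * ΣC {q} {n} (λ _ → 1)               ≤⟨ ℕ.*-monoʳ-≤ q (ΣC-mono _ _ someHit) ⟩
    q * ΣC (λ c → sum (λ w → hit w c))     ≡⟨ cong (q *_) (ΣC-sum hit) ⟩
    q * sum (λ w → ΣC (hit w))             ≡⟨ sum-* q (λ w → ΣC (hit w)) ⟨
    sum (λ w → q * ΣC (hit w))             ≡⟨ sum-cong-≗ hits ⟩
    sum {n} (λ _ → q ^ n)                  ≡⟨ sum-const n (q ^ n) ⟩
    n * q ^ n                              ∎)
  where
  open ℕ.≤-Reasoning

  hit : Fin n → Colouring q n → ℕ
  hit w c = indicator (s w (view G c w) Fin.≟ lookup c w)

  someHit : ∀ c → 1 ≤ sum (λ w → hit w c)
  someHit c with win c
  ... | w , eq = ℕ.≤-trans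
    (ℕ.≤-reflexive (sym (cong (if_then 1 else 0)
                              (dec-true (s w (view G c w) Fin.≟ lookup c w) eq))))
    (term≤sum (λ w → hit w c) w)

  hit-recolour : ∀ w c x → hit w (c [ w ]≔ x) ≡ indicator (s w (view G c w) Fin.≟ x)
  hit-recolour w c x rewrite view-update G c w x | lookup∘update w c x = refl

  hits : ∀ w → q * ΣC (hit w) ≡ q ^ n
  hits w = trans (sym (ΣC-recolour w (hit w)))
    (trans (ΣC-cong _ _ (λ c → trans (sum-cong-≗ (hit-recolour w c))
                                     (sum-indicator (s w (view G c w)))))
           (ΣC-one q n))

------------------------------------------------------------------------
-- The hat guessing number

-- The largest k ≤ b satisfying P, or 0 if there is none.
largestUpTo : ∀ {P : Pred ℕ 0ℓ} → Decidable P → ℕ → ℕ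
largestUpTo P? zero    = zero
largestUpTo P? (suc b) = if does (P? (suc b)) then suc b else largestUpTo P? b

-- Searching up to n suffices by winnable⇒≤.  The graph without vertices,
-- on which no strategy wins, is assigned 0.
HG : ∀ {n} → Graph n → ℕ
HG {n} G = largestUpTo (winnable? G) n

largestUpTo-upper : ∀ {P : Pred ℕ 0ℓ} (P? : Decidable P) b k →
                    k ≤ b → P k → k ≤ largestUpTo P? b
largestUpTo-upper P? zero    k k≤b p = k≤b
largestUpTo-upper P? (suc b) k k≤b p with P? (suc b)
... | yes _  = k≤b
... | no ¬p = largestUpTo-upper P? b k (ℕ.≤-pred (ℕ.≤∧≢⇒< k≤b λ { refl → ¬p p })) p

largestUpTo-sat : ∀ {P : Pred ℕ 0ℓ} (P? : Decidable P) b k →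
                  0 < k → k ≤ b → P k → P (largestUpTo P? b)
largestUpTo-sat P? zero    k 0<k k≤b p = contradiction (ℕ.≤-trans 0<k k≤b) λ ()
largestUpTo-sat P? (suc b) k 0<k k≤b p with P? (suc b)
... | yes q = q
... | no ¬p = largestUpTo-sat P? b k 0<k (ℕ.≤-pred (ℕ.≤∧≢⇒< k≤b λ { refl → ¬p p })) p

winnable-1 : ∀ {n} (G : Graph (suc n)) → Winnable G 1
winnable-1 G = (λ _ _ → zero) , λ c → zero , one (lookup c zero)
  where
  one : (x : Fin 1) → zero ≡ x
  one zero = refl

HG-isHatGuessingNumber : ∀ {n} (G : Graph (suc n)) → IsHatGuessingNumber G (HG G)
HG-isHatGuessingNumber {n} G =
    largestUpTo-sat (winnable? G) (suc n) 1 (s≤s z≤n) (s≤s z≤n) (winnable-1 G)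
  , λ q win → largestUpTo-upper (winnable? G) (suc n) q (winnable⇒≤ G q win) win

------------------------------------------------------------------------
-- The binomial random graph

-- One bit per unordered pair of vertices: the head vector of a table holds the
-- pairs containing vertex zero, the tail those among the remaining vertices.
data EdgeBits : ℕ → Set where
  []  : EdgeBits zero
  _∷_ : ∀ {n} → Vec Bool n → EdgeBits n → EdgeBits (suc n)

edgeBit : ∀ {n} → EdgeBits n → Fin n → Fin n → Bool
edgeBit (r ∷ e) zero    zero    = false
edgeBit (r ∷ e) zero    (suc j) = lookup r j
edgeBit (r ∷ e) (suc i) zero    = lookup r i
edgeBit (r ∷ e) (suc i) (suc j) = edgeBit e i j

toGraph : ∀ {n} → EdgeBits n → Graph n
toGraph e = record
  { adj = edgeBit e ; symmetric = symm e ; irreflexive = irr e }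
  where
  symm : ∀ {n} (e : EdgeBits n) v w → edgeBit e v w ≡ edgeBit e w v
  symm (r ∷ e) zero    zero    = refl
  symm (r ∷ e) zero    (suc j) = refl
  symm (r ∷ e) (suc i) zero    = refl
  symm (r ∷ e) (suc i) (suc j) = symm e i j

  irr : ∀ {n} (e : EdgeBits n) v → edgeBit e v v ≡ false
  irr (r ∷ e) zero    = refl
  irr (r ∷ e) (suc i) = irr e i

-- Expectations with respect to independent bits that are true with
-- probability p.
𝔼-bits : ℚ → ∀ m → (Vec Bool m → ℚ) → ℚ
𝔼-bits p zero    X = X []
𝔼-bits p (suc m) X =
  p ℚ.* 𝔼-bits p m (λ b → X (true ∷ b))
    ℚ.+ (1ℚ ℚ.- p) ℚ.* 𝔼-bits p m (λ b → X (false ∷ b))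

𝔼-edges : ℚ → ∀ n → (EdgeBits n → ℚ) → ℚ
𝔼-edges p zero    X = X []
𝔼-edges p (suc n) X = 𝔼-bits p n (λ r → 𝔼-edges p n (λ e → X (r ∷ e)))

-- The probability that G(n,p) satisfies A.
ℙ[G⟨_,_⟩∈_] : ∀ n → ℚ → {A : Pred (Graph n) 0ℓ} → Decidable A → ℚ
ℙ[G⟨ n , p ⟩∈ A? ] = 𝔼-edges p n (λ e → if does (A? (toGraph e)) then 1ℚ else 0ℚ)

------------------------------------------------------------------------
-- Asymptotics

infix 4 _⟶_

_⟶_ : (ℕ → ℚ) → ℚ → Set
a ⟶ L = ∀ δ → 0ℚ ℚ.< δ → ∃[ N ] ∀ n → N ≤ n → ℚ.∣ a n ℚ.- L ∣ ℚ.< δ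

-- n ^ r ≤ h for a rational exponent r, obtained by raising both sides to the
-- power of the denominator of r and, if r < 0, multiplying out the negative
-- power of n.
RationalPower≤ : ℕ → ℚ → ℕ → Set
RationalPower≤ n r h with ℚ.numerator r
... | + a      = n ^ a ≤ h ^ ℚ.denominatorℕ r
... | -[1+ a ] = 1 ≤ h ^ ℚ.denominatorℕ r * n ^ suc a

rationalPower≤? : ∀ n r h → Dec (RationalPower≤ n r h)
rationalPower≤? n r h with ℚ.numerator r
... | + a      = n ^ a ℕ.≤? h ^ ℚ.denominatorℕ r
... | -[1+ a ] = 1 ℕ.≤? h ^ ℚ.denominatorℕ r * n ^ suc a

{-# OPTIONS --safe #-}

-- Let G contain a book: a clique of d vertices (the spine) all of which are
-- joined to N further vertices (the pages).  Each page guesses by a function of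
-- the colouring of the spine.  Choosing these functions well, by averaging, we
-- ensure that for every colouring of the pages fewer than N colourings of the
-- spine make all pages guess wrong; this needs N of order q d log q.  The spine
-- knows the page colours and hence this set S of bad colourings, and wins on it
-- if |S| < b^(d/2) with b ≤ d/2: call a coordinate of x ∈ S heavy if it leaves at
-- least a fraction 1/b of the members of S that agree with x before it.  Each
-- x ∈ S has fewer than d/2 light coordinates, so lies on at least d/2 heavy
-- lines, while a line has at most b heavy points; hence the points of S can be
-- assigned to distinct lines through them, and the player of a line guesses the
-- point assigned to it.  Since b^(d/2) is superexponential in d, a spine of size
-- d = o(log n) suffices for q = n^(1-o(1)), and for such d a greedy choice of the
-- spine in G(n,1/2) leaves n^(1-o(1)) common neighbours with high probability.

module Submission where

open import Defs
open import Data.Bool.Base using (Bool; true; false; T; if_then_else_; not; _∧_)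
import Data.Bool.Properties as Bool
open import Data.Bool.Properties using (T?; T-≡)
open import Data.Empty using (⊥-elim)
open import Data.Fin.Base using (Fin; zero; suc; combine; _↑ˡ_; _↑ʳ_)
import Data.Fin.Properties as Fin
import Data.Integer.Base as ℤ
import Data.Integer.Tactic.RingSolver as ℤ
open import Data.List.Base
  using (List; []; _∷_; length; filter; map; _++_; allFin; cartesianProductWith)
open import Data.List.Membership.Propositional using (_∈_; _∉_; find; lose)
open import Data.List.Membership.Propositional.Properties
  using (∈-filter⁺; ∈-filter⁻; ∈-map⁺; ∈-map⁻; ∈-++⁺ˡ; ∈-++⁺ʳ; ∈-++⁻; ∈-allFin;
         ∈-cartesianProductWith⁺)
open import Data.List.Properties using (length-map; length-++; filter-notAll)
open import Data.List.Relation.Unary.All as All using (All; []; _∷_)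
open import Data.List.Relation.Unary.AllPairs using ([]; _∷_)
open import Data.List.Relation.Unary.Any as Any using (Any; here; there)
open import Data.List.Relation.Unary.Unique.Propositional using (Unique)
import Data.List.Relation.Unary.Unique.Propositional.Properties as Unique
open import Data.Nat.Base using (ℕ; zero; suc; z≤n; s≤s)
import Data.Nat.Base as ℕ
import Data.Nat.Coprimality as Coprime
import Data.Nat.ListAction as List
import Data.Nat.Properties as ℕ
open import Data.Nat.Tactic.RingSolver using (solve-∀)
open import Data.Product.Base using (Σ; ∃; _×_; _,_; proj₁; proj₂)
open import Data.Product.Properties using (≡-dec)
open import Data.Rational.Base using (ℚ; 0ℚ; 1ℚ; ½; _-_; ∣_∣)
import Data.Rational.Properties as ℚ
open import Data.Rational.Solver using (module +-*-Solver)
import Data.Rational.Unnormalised.Base as ℚᵘ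
import Data.Rational.Unnormalised.Properties as ℚᵘ
open import Data.Sum.Base using (_⊎_; inj₁; inj₂)
open import Data.Vec.Base as Vec
  using (Vec; []; _∷_; lookup; tabulate; fromList; zipWith; _[_]≔_)
import Data.Vec.Properties as Vec
open import Function.Base using (_∘_)
open import Function.Bundles using (Equivalence)
open import Relation.Binary.Definitions using (DecidableEquality)
open import Relation.Binary.PropositionalEquality
  using (_≡_; _≢_; refl; sym; trans; cong; cong₂; subst; module ≡-Reasoning)
open import Relation.Nullary.Decidable
  using (Dec; yes; no; does; ¬?; _×-dec_; decidable-stable; dec-true; dec-false)
open import Relation.Nullary.Negation using (¬_; contradiction)
open import Algebra.Properties.CommutativeSemigroup ℕ.+-commutativeSemigroup
  using (interchange)
open import Algebra.Properties.CommutativeMonoid.Sum ℕ.+-0-commutativeMonoid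
  using (sum; sum-cong-≗; ∑-distrib-+)

module HatGuessing where

  open import Data.Nat.Base
  open import Data.Nat.DivMod
    using (_/_; _%_; m/n*n≤m; m≡m%n+[m/n]*n; m%n<n; m*n/n≡m; /-monoˡ-≤)
  open import Data.Nat.Properties using (module ≤-Reasoning; _≤?_)

  -- Matching by counting slots

  𝟙 : Bool → ℕ
  𝟙 b = if b then 1 else 0

  ¬T⇒false : ∀ {b} → ¬ T b → b ≡ false
  ¬T⇒false {false} _  = refl
  ¬T⇒false {true}  ¬t = ⊥-elim (¬t _)

  ΣL : {X : Set} → (X → ℕ) → List X → ℕ
  ΣL f xs = List.sum (map f xs)

  ΣL-mono : ∀ {X : Set} {f g : X → ℕ} xs → (∀ {x} → x ∈ xs → f x ≤ g x) → ΣL f xs ≤ ΣL g xs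
  ΣL-mono []       f≤g = z≤n
  ΣL-mono (x ∷ xs) f≤g = ℕ.+-mono-≤ (f≤g (here refl)) (ΣL-mono xs (f≤g ∘ there))

  ΣL-const : ∀ {X : Set} k (xs : List X) → ΣL (λ _ → k) xs ≡ length xs * k
  ΣL-const k []       = refl
  ΣL-const k (x ∷ xs) = cong (k +_) (ΣL-const k xs)

  sum-ΣL : ∀ {X : Set} {m} (f : Fin m → X → ℕ) xs →
           sum (λ i → ΣL (f i) xs) ≡ ΣL (λ x → sum (λ i → f i x)) xs
  sum-ΣL {m = m} f []       = trans (sum-const m 0) (ℕ.*-zeroʳ m)
  sum-ΣL         f (x ∷ xs) =
    trans (∑-distrib-+ (λ i → f i x) (λ i → ΣL (f i) xs))
          (cong (sum (λ i → f i x) +_) (sum-ΣL f xs))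

  ΣL-+ : ∀ {X : Set} (f g : X → ℕ) xs → ΣL (λ x → f x + g x) xs ≡ ΣL f xs + ΣL g xs
  ΣL-+ f g []       = refl
  ΣL-+ f g (x ∷ xs) =
    trans (cong (f x + g x +_) (ΣL-+ f g xs)) (interchange (f x) (g x) _ _)

  ΣL-comm : ∀ {X Y : Set} (f : X → Y → ℕ) xs ys →
            ΣL (λ x → ΣL (f x) ys) xs ≡ ΣL (λ y → ΣL (λ x → f x y) xs) ys
  ΣL-comm f []       ys = sym (trans (ΣL-const 0 ys) (ℕ.*-zeroʳ (length ys)))
  ΣL-comm f (x ∷ xs) ys =
    trans (cong (ΣL (f x) ys +_) (ΣL-comm f xs ys)) (sym (ΣL-+ (f x) _ ys))

  term≤ΣL : ∀ {X : Set} (f : X → ℕ) {x xs} → x ∈ xs → f x ≤ ΣL f xs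
  term≤ΣL f (here refl) = ℕ.m≤m+n _ _
  term≤ΣL f (there x∈)  = ℕ.≤-trans (term≤ΣL f x∈) (ℕ.m≤n+m _ _)

  -- `X` and `Y` will be the colourings of the spine and its axis-parallel lines, `ℓ i x` being the
  -- line through `x` in direction `i`. By double counting, `slots` and `load` give Hall's
  -- condition.
  module SlotMatching
    {X Y : Set} (_≟X_ : DecidableEquality X) (_≟Y_ : DecidableEquality Y)
    {d : ℕ} (i₀ : Fin d) (ℓ : Fin d → X → Y) (usable : X → Fin d → Bool)
    (P : X → Set) (k : ℕ) .{{_ : NonZero k}}
    (slots : ∀ x → P x → k ≤ sum (λ i → 𝟙 (usable x i)))
    (load : ∀ y A → Unique A → All P A →
            ΣL (λ x → sum (λ i → 𝟙 (usable x i) * indicator (ℓ i x ≟Y y))) A ≤ k)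
    where

    own : (X → Fin d) → X → Y
    own φ x = ℓ (φ x) x

    Valid : (X → Fin d) → (X → Set) → Set
    Valid φ D = (∀ x → D x → T (usable x (φ x)))
              × (∀ x y → D x → D y → own φ x ≡ own φ y → x ≡ y)

    FreeSlot : List Y → X → Set
    FreeSlot taken x = ∃ λ i → T (usable x i) × ℓ i x ∉ taken

    freeSlot? : ∀ taken x → Dec (FreeSlot taken x)
    freeSlot? taken x =
      Fin.any? (λ i → T? (usable x i) ×-dec ¬? (Any.any? (ℓ i x ≟Y_) taken))

    -- If all usable slots of A were on taken lines, there would be at most
    -- k |taken| < k |A| of them.
    freeSlot : ∀ A taken → Unique A → All P A → length taken < length A →
               ∃ λ x → x ∈ A × FreeSlot taken x
    freeSlot A taken unique ps short with Any.any? (freeSlot? taken) A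
    ... | yes any = let (x , x∈A , free) = find any in x , x∈A , free
    ... | no none = contradiction short (ℕ.≤⇒≯ (ℕ.*-cancelʳ-≤ (length A) (length taken) k (begin
      length A * k                                      ≡⟨ ΣL-const k A ⟨
      ΣL (λ _ → k) A                                    ≤⟨ ΣL-mono A (λ {x} x∈ → slots x (All.lookup ps x∈)) ⟩
      ΣL (λ x → sum (λ i → 𝟙 (usable x i))) A           ≤⟨ ΣL-mono A (λ {x} x∈ → sum-mono _ _ (onTaken x x∈)) ⟩
      ΣL (λ x → sum (λ i → ΣL (weight x i) taken)) A    ≤⟨ ΣL-mono A (λ {x} _ → ℕ.≤-reflexive (sum-ΣL (weight x) taken)) ⟩
      ΣL (λ x → ΣL (λ y → sum (λ i → weight x i y)) taken) A ≡⟨ ΣL-comm _ A taken ⟩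
      ΣL (λ y → ΣL (λ x → sum (λ i → weight x i y)) A) taken ≤⟨ ΣL-mono taken (λ {y} _ → load y A unique ps) ⟩
      ΣL (λ _ → k) taken                                ≡⟨ ΣL-const k taken ⟩
      length taken * k                                  ∎)))
      where
      open ≤-Reasoning
      weight : X → Fin d → Y → ℕ
      weight x i y = 𝟙 (usable x i) * indicator (ℓ i x ≟Y y)

      onTaken : ∀ x → x ∈ A → ∀ i → 𝟙 (usable x i) ≤ ΣL (weight x i) taken
      onTaken x x∈ i with T? (usable x i)
      ... | no unusable rewrite ¬T⇒false unusable = z≤n
      ... | yes u with Any.any? (ℓ i x ≟Y_) taken
      ...   | no ∉taken = contradiction (lose x∈ (i , u , ∉taken)) none
      ...   | yes ∈taken = ℕ.≤-trans (ℕ.≤-reflexive (sym weight≡𝟙)) (term≤ΣL (weight x i) ∈taken)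
        where
        weight≡𝟙 : weight x i (ℓ i x) ≡ 𝟙 (usable x i)
        weight≡𝟙 rewrite dec-true (ℓ i x ≟Y ℓ i x) refl = ℕ.*-identityʳ _

    _[_:=_] : (X → Fin d) → X → Fin d → X → Fin d
    (φ [ a := i ]) x = if does (x ≟X a) then i else φ x

    :=-same : ∀ φ a i → (φ [ a := i ]) a ≡ i
    :=-same φ a i rewrite dec-true (a ≟X a) refl = refl

    :=-other : ∀ φ {a x} i → x ≢ a → (φ [ a := i ]) x ≡ φ x
    :=-other φ {a} {x} i x≢a rewrite dec-false (x ≟X a) x≢a = refl

    valid-:= : ∀ {ψ a i} {D E : X → Set} → Valid ψ D → T (usable a i) →
               (∀ x → E x → x ≢ a → D x) →
               (∀ x → E x → x ≢ a → own ψ x ≢ ℓ i a) →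
               Valid (ψ [ a := i ]) E
    valid-:= {ψ} {a} {i} {D} {E} (used , inj) u E⊆D avoids = used′ , inj′
      where
      used′ : ∀ x → E x → T (usable x ((ψ [ a := i ]) x))
      used′ x ex with x ≟X a
      ... | yes refl = u
      ... | no x≢a   = used x (E⊆D x ex x≢a)

      inj′ : ∀ x y → E x → E y → own (ψ [ a := i ]) x ≡ own (ψ [ a := i ]) y → x ≡ y
      inj′ x y ex ey eq with x ≟X a | y ≟X a
      ... | yes refl | yes refl = refl
      ... | yes refl | no y≢a   = contradiction (sym eq) (avoids y ey y≢a)
      ... | no x≢a   | yes refl = contradiction eq (avoids x ex x≢a)
      ... | no x≢a   | no y≢a   = inj x y (E⊆D x ex x≢a) (E⊆D y ey y≢a) eq

    -- A matching φ of D is extended to x₀ ∷ D by growing the set x₀ ∷ A of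
    -- vertices reachable from x₀ along alternating paths; `Exchanged a` is the
    -- result of flipping a path from x₀ to a, which leaves a unmatched.
    module Augment (x₀ : X) (D : List X) (x₀∉D : x₀ ∉ D) (Px₀ : P x₀) (PD : All P D)
                   (φ : X → Fin d) (φ-valid : Valid φ (_∈ D)) where

      record Exchanged (A : List X) (a : X) : Set where
        field
          ψ     : X → Fin d
          valid : Valid ψ (λ x → x ∈ x₀ ∷ D × x ≢ a)
          agree : ∀ z → z ∈ D → z ∉ A → ψ z ≡ φ z
          lines : ∀ x → x ∈ x₀ ∷ D → x ≢ a → ∃ λ z → z ∈ D × own ψ x ≡ own φ z
      open Exchanged

      -- Under `φ`, `A` owns fewer lines than `x₀ ∷ A` has members, so `freeSlot` finds a member `a`
      -- with a usable line outside these. If nobody in `D` owns that line, flipping the path to `a`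
      -- finishes; otherwise its owner `z` joins `A`. `R` contains the members of `D` not yet
      -- reached and shrinks in each round, so `fuel` cannot run out.
      grow : ∀ fuel A R → length R ≤ fuel → Unique (x₀ ∷ A) → (∀ {z} → z ∈ A → z ∈ D) →
             (∀ {z} → z ∈ D → z ∉ A → z ∈ R) →
             (∀ a → a ∈ x₀ ∷ A → Exchanged A a) →
             ∃ λ ψ → Valid ψ (_∈ x₀ ∷ D)
      grow fuel A R R≤ unique A⊆D rest exch
        with freeSlot (x₀ ∷ A) (map (own φ) A) unique (Px₀ ∷ All.tabulate (λ z∈ → All.lookup PD (A⊆D z∈)))
               (s≤s (ℕ.≤-reflexive (length-map (own φ) A)))
      ... | a , a∈ , i , u , y∉
        with Any.any? (λ z → ℓ i a ≟Y own φ z) D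
      ... | no unused = ψ (exch a a∈) [ a := i ] ,
            valid-:= (valid (exch a a∈)) u (λ x x∈ x≢a → x∈ , x≢a)
              (λ x x∈ x≢a eq → let (z , z∈ , eq′) = lines (exch a a∈) x x∈ x≢a in
                 unused (lose z∈ (trans (sym eq) eq′)))
      ... | yes usedBy with find usedBy
      ...   | z , z∈D , y≡ = continue fuel R≤
        where
        z∉A : z ∉ A
        z∉A z∈A = y∉ (subst (_∈ map (own φ) A) (sym y≡) (∈-map⁺ (own φ) z∈A))

        z∉x₀A : z ∉ x₀ ∷ A
        z∉x₀A (here refl) = x₀∉D z∈D
        z∉x₀A (there z∈A) = z∉A z∈A

        z≢a : z ≢ a
        z≢a refl = z∉x₀A a∈

        e = exch a a∈

        z-exchanged : Exchanged (z ∷ A) z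
        z-exchanged .ψ = ψ e [ a := i ]
        z-exchanged .valid = valid-:= (valid e) u (λ { x (x∈ , _) x≢a → x∈ , x≢a })
          -- As `z` is not in `A`, `ψ` still gives `z` its line under `φ`, so by validity no other
          -- vertex owns that line.
          (λ { x (x∈ , x≢z) x≢a eq → x≢z (proj₂ (valid e) x z (x∈ , x≢a) (there z∈D , z≢a)
             (trans eq (trans y≡ (cong (λ j → ℓ j z) (sym (agree e z z∈D z∉A)))))) })
        z-exchanged .agree w w∈D w∉ = trans (:=-other (ψ e) i w≢a) (agree e w w∈D (w∉ ∘ there))
          where
          notIn : ∀ {w} → w ∈ D → w ∉ z ∷ A → w ∉ x₀ ∷ A
          notIn w∈D w∉ (here refl) = x₀∉D w∈D
          notIn w∈D w∉ (there w∈A) = w∉ (there w∈A)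

          w≢a : w ≢ a
          w≢a refl = notIn w∈D w∉ a∈
        z-exchanged .lines x x∈ x≢z with x ≟X a
        ... | yes refl = z , z∈D , y≡
        ... | no x≢a = lines e x x∈ x≢a

        weaken : ∀ {b} → Exchanged A b → Exchanged (z ∷ A) b
        weaken e = record { ψ = ψ e ; valid = valid e ; lines = lines e
                          ; agree = λ w w∈ w∉ → agree e w w∈ (w∉ ∘ there) }

        exch′ : ∀ b → b ∈ x₀ ∷ z ∷ A → Exchanged (z ∷ A) b
        exch′ b (there (here refl)) = z-exchanged
        exch′ b (here b≡) = weaken (exch b (here b≡))
        exch′ b (there (there b∈)) = weaken (exch b (there b∈))

        unique′ : Unique (x₀ ∷ z ∷ A)
        unique′ = insert unique
          where
          insert : Unique (x₀ ∷ A) → Unique (x₀ ∷ z ∷ A)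
          insert (x₀≢ ∷ uA) = ((λ x₀≡z → z∉x₀A (here (sym x₀≡z))) ∷ x₀≢)
                              ∷ (All.tabulate (λ w∈ z≡w → z∉A (subst (_∈ A) (sym z≡w) w∈)) ∷ uA)

        R′ = filter (λ w → ¬? (w ≟X z)) R

        R-shrinks : length R′ < length R
        R-shrinks = filter-notAll (λ w → ¬? (w ≟X z)) R
                      (Any.map (λ { refl z≢z → z≢z refl }) (rest z∈D z∉A))

        continue : ∀ fuel → length R ≤ fuel → ∃ λ ψ → Valid ψ (_∈ x₀ ∷ D)
        continue zero       R≤ = contradiction (ℕ.<-≤-trans R-shrinks R≤) λ ()
        continue (suc fuel) R≤ = grow fuel (z ∷ A) R′
          (ℕ.≤-pred (ℕ.≤-trans R-shrinks R≤))
          unique′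
          (λ { (here refl) → z∈D ; (there w∈) → A⊆D w∈ })
          (λ w∈D w∉ → ∈-filter⁺ (λ w → ¬? (w ≟X z)) (rest w∈D (w∉ ∘ there)) (w∉ ∘ here))
          exch′

      augment : ∃ λ ψ → Valid ψ (_∈ x₀ ∷ D)
      augment = grow (length D) [] D ℕ.≤-refl ([] ∷ []) (λ ()) (λ z∈ _ → z∈) start
        where
        inD : ∀ {x} → x ∈ x₀ ∷ D × x ≢ x₀ → x ∈ D
        inD (here refl , x≢) = contradiction refl x≢
        inD (there x∈ , _)   = x∈

        start : ∀ a → a ∈ x₀ ∷ [] → Exchanged [] a
        start a (here refl) = record
          { ψ = φ
          ; valid = (λ x x∈ → proj₁ φ-valid x (inD x∈))
                  , (λ x y x∈ y∈ → proj₂ φ-valid x y (inD x∈) (inD y∈))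
          ; agree = λ _ _ _ → refl
          ; lines = λ x x∈ x≢ → x , inD (x∈ , x≢) , refl }

    matching : ∀ D → Unique D → All P D → ∃ λ φ → Valid φ (_∈ D)
    matching []      _             _          = (λ _ → i₀) , (λ _ ()) , (λ _ _ ())
    matching (x ∷ D) (x≢ ∷ unique) (px ∷ ps) =
      let (φ , φ-valid) = matching D unique ps in
      Augment.augment x D (λ x∈ → All.lookup x≢ x∈ refl) px ps φ φ-valid

  -- Winning on few colourings of a clique

  _≟C_ : ∀ {q n} → DecidableEquality (Colouring q n)
  _≟C_ = Vec.≡-dec Fin._≟_

  ∣_∣C : ∀ {q n} → (Colouring q n → Bool) → ℕ
  ∣ S ∣C = ΣC (𝟙 ∘ S)

  term≤ΣC : ∀ {q n} (f : Colouring q n → ℕ) c → f c ≤ ΣC f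
  term≤ΣC f []      = ℕ.≤-refl
  term≤ΣC f (a ∷ c) =
    ℕ.≤-trans (term≤ΣC (f ∘ (a ∷_)) c) (term≤sum (λ a → ΣC (f ∘ (a ∷_))) a)

  allColourings : ∀ q n → List (Colouring q n)
  allColourings q zero    = [] ∷ []
  allColourings q (suc n) = cartesianProductWith _∷_ (allFin q) (allColourings q n)

  ∈-allColourings : ∀ {q n} (c : Colouring q n) → c ∈ allColourings q n
  ∈-allColourings []      = here refl
  ∈-allColourings (a ∷ c) = ∈-cartesianProductWith⁺ _∷_ (∈-allFin a) (∈-allColourings c)

  allColourings-unique : ∀ q n → Unique (allColourings q n)
  allColourings-unique q zero    = [] ∷ []
  allColourings-unique q (suc n) =
    Unique.cartesianProductWith⁺ _∷_ Vec.∷-injective (Unique.allFin⁺ q) (allColourings-unique q n)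

  lookup-ext : ∀ {A : Set} {n} (u v : Vec A n) → (∀ i → lookup u i ≡ lookup v i) → u ≡ v
  lookup-ext u v eq =
    trans (sym (Vec.tabulate∘lookup u)) (trans (Vec.tabulate-cong eq) (Vec.tabulate∘lookup v))

  ≔-cong : ∀ {q n} (c c′ : Colouring q n) i a → (∀ j → j ≢ i → lookup c j ≡ lookup c′ j) →
           c [ i ]≔ a ≡ c′ [ i ]≔ a
  ≔-cong c c′ i a off = lookup-ext _ _ same
    where
    same : ∀ j → lookup (c [ i ]≔ a) j ≡ lookup (c′ [ i ]≔ a) j
    same j with j Fin.≟ i
    ... | yes refl = trans (Vec.lookup∘update i c a) (sym (Vec.lookup∘update i c′ a))
    ... | no j≢i   = trans (Vec.lookup∘update′ j≢i c a)
                       (trans (off j j≢i) (sym (Vec.lookup∘update′ j≢i c′ a)))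

  restore : ∀ {q n} (c : Colouring q n) i a → (c [ i ]≔ a) [ i ]≔ lookup c i ≡ c
  restore c i a = trans (Vec.[]≔-idempotent c i) (Vec.[]≔-lookup c i)

  -- The coordinate i of x is heavy if, among the members of S agreeing with x
  -- before i, at least a fraction 1/b also agree with x at i.
  heavy : ∀ {q n} → ℕ → (Colouring q n → Bool) → Colouring q n → Fin n → Bool
  heavy b S (a ∷ x) zero    = ∣ S ∣C ≤ᵇ b * ∣ S ∘ (a ∷_) ∣C
  heavy b S (a ∷ x) (suc i) = heavy b (S ∘ (a ∷_)) x i

  -- Every light coordinate reduces the number of candidates by a factor of b.
  ^-lights≤ : ∀ {q n} b (S : Colouring q n → Bool) x → S x ≡ true →
              b ^ sum (λ i → 𝟙 (not (heavy b S x i))) ≤ ∣ S ∣C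
  ^-lights≤ b S []      x∈S rewrite x∈S = ℕ.≤-refl
  ^-lights≤ b S (a ∷ x) x∈S with ∣ S ∣C ≤ᵇ b * ∣ S ∘ (a ∷_) ∣C in light
  ... | true  = ℕ.≤-trans (^-lights≤ b (S ∘ (a ∷_)) x x∈S)
                          (term≤sum (λ a → ∣ S ∘ (a ∷_) ∣C) a)
  ... | false = ℕ.≤-trans (ℕ.*-monoʳ-≤ b (^-lights≤ b (S ∘ (a ∷_)) x x∈S))
                             (ℕ.<⇒≤ (ℕ.≰⇒> (λ h → subst T light (ℕ.≤⇒≤ᵇ h))))

  𝟙+𝟙-not : ∀ b → 𝟙 b + 𝟙 (not b) ≡ 1
  𝟙+𝟙-not true  = refl
  𝟙+𝟙-not false = refl

  heavies+lights : ∀ {n} (h : Fin n → Bool) → sum (𝟙 ∘ h) + sum (𝟙 ∘ not ∘ h) ≡ n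
  heavies+lights {n} h =
    trans (sym (∑-distrib-+ (𝟙 ∘ h) (𝟙 ∘ not ∘ h)))
    (trans (sum-cong-≗ (𝟙+𝟙-not ∘ h)) (trans (sum-const n 1) (ℕ.*-identityʳ n)))

  -- With `k` or more light coordinates, `^-lights≤` would give at least `b ^ k` members of `S`;
  -- hence at least half of the `k + k` coordinates are heavy.
  many-heavies : ∀ {q k} b .{{_ : NonZero b}} (S : Colouring q (k + k) → Bool) → ∣ S ∣C < b ^ k →
                 ∀ x → S x ≡ true → k ≤ sum (λ i → 𝟙 (heavy b S x i))
  many-heavies {q} {k} b S small x x∈S =
    ℕ.+-cancelʳ-≤ k k heavies (begin
      k + k            ≡⟨ heavies+lights (heavy b S x) ⟨
      heavies + lights ≤⟨ ℕ.+-monoʳ-≤ heavies lights≤k ⟩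
      heavies + k      ∎)
    where
    open ≤-Reasoning
    heavies = sum (λ i → 𝟙 (heavy b S x i))
    lights  = sum (λ i → 𝟙 (not (heavy b S x i)))

    lights≤k : lights ≤ k
    lights≤k = ℕ.≮⇒≥ λ k<lights → contradiction small
      (ℕ.≤⇒≯ (ℕ.≤-trans (ℕ.^-monoʳ-≤ b (ℕ.<⇒≤ k<lights)) (^-lights≤ b S x x∈S)))

  -- The points of a line in direction `i` agree before `i`, so their heaviness at `i` refers to one
  -- common set of candidates, split into disjoint parts by the colour at `i`. At most `b` parts of
  -- a non-empty set can hold a fraction 1/b of it.
  few-heavies-on-line : ∀ {q n} b (S : Colouring q n → Bool) z i →
    sum (λ a → 𝟙 (S (z [ i ]≔ a)) * 𝟙 (heavy b S (z [ i ]≔ a) i)) ≤ b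
  few-heavies-on-line         b S (a ∷ z) (suc i) = few-heavies-on-line b (S ∘ (a ∷_)) z i
  few-heavies-on-line {q} {suc n} b S (_ ∷ z) zero    = cases ∣ S ∣C refl
    where
    size : Fin q → ℕ
    size a = ∣ S ∘ (a ∷_) ∣C

    term : Fin q → ℕ
    term a = 𝟙 (S (a ∷ z)) * 𝟙 (heavy b S (a ∷ z) zero)

    weigh : ∀ a → ∣ S ∣C * term a ≤ b * size a
    weigh a with S (a ∷ z)
    ... | false = ℕ.≤-trans (ℕ.≤-reflexive (ℕ.*-zeroʳ ∣ S ∣C)) z≤n
    ... | true with ∣ S ∣C ≤ᵇ b * ∣ S ∘ (a ∷_) ∣C in h
    ...   | true  = ℕ.≤-trans (ℕ.≤-reflexive (ℕ.*-identityʳ ∣ S ∣C))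
                              (ℕ.≤ᵇ⇒≤ _ _ (subst T (sym h) _))
    ...   | false = ℕ.≤-trans (ℕ.≤-reflexive (ℕ.*-zeroʳ ∣ S ∣C)) z≤n

    term≤∣S∣ : ∀ a → term a ≤ size a
    term≤∣S∣ a = ℕ.≤-trans (small (S (a ∷ z)) _) (term≤ΣC (𝟙 ∘ S ∘ (a ∷_)) z)
      where
      small : ∀ u v → 𝟙 u * 𝟙 v ≤ 𝟙 u
      small false v     = z≤n
      small true  false = z≤n
      small true  true  = ℕ.≤-refl

    cases : ∀ m → ∣ S ∣C ≡ m → sum term ≤ b
    -- Dividing by `∣ S ∣C` requires it to be positive; otherwise the line has no point in `S`.
    cases zero    ∣S∣≡0 = ℕ.≤-trans (sum-mono term size term≤∣S∣)
                           (ℕ.≤-trans (ℕ.≤-reflexive ∣S∣≡0) z≤n)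
    cases (suc m) ∣S∣≡m = ℕ.*-cancelˡ-≤ (suc m) (begin
      suc m * sum term               ≡⟨ sum-* (suc m) term ⟨
      sum (λ a → suc m * term a)     ≡⟨ sum-cong-≗ (λ a → cong (_* term a) ∣S∣≡m) ⟨
      sum (λ a → ∣ S ∣C * term a)    ≤⟨ sum-mono _ _ weigh ⟩
      sum (λ a → b * size a)         ≡⟨ sum-* b size ⟩
      b * ∣ S ∣C                     ≡⟨ cong (b *_) ∣S∣≡m ⟩
      b * suc m                      ≡⟨ ℕ.*-comm b (suc m) ⟩
      suc m * b                      ∎)
      where open ≤-Reasoning

  ΣL-point : ∀ {X : Set} (_≟_ : DecidableEquality X) (w : X → ℕ) y A → Unique A →
             ΣL (λ x → indicator (y ≟ x) * w x) A ≤ w y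
  ΣL-point _≟_ w y []      _ = z≤n
  ΣL-point _≟_ w y (x ∷ A) (x≢ ∷ unique) with y ≟ x
  ... | no _ = ΣL-point _≟_ w y A unique
  ... | yes refl = ℕ.≤-reflexive (trans (cong₂ _+_ (ℕ.*-identityˡ (w y)) (absent A x≢)) (ℕ.+-identityʳ (w y)))
    where
    absent : ∀ A → All (y ≢_) A → ΣL (λ x → indicator (y ≟ x) * w x) A ≡ 0
    absent []      []        = refl
    absent (z ∷ A) (y≢z ∷ y≢) rewrite dec-false (y ≟ z) y≢z = absent A y≢

  sum-single : ∀ {n} (f : Fin n → ℕ) i₀ v → (∀ i → f i ≤ v * indicator (i₀ Fin.≟ i)) → sum f ≤ v
  sum-single f i₀ v f≤ = begin
    sum f                                     ≤⟨ sum-mono f _ f≤ ⟩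
    sum (λ i → v * indicator (i₀ Fin.≟ i))    ≡⟨ sum-* v (λ i → indicator (i₀ Fin.≟ i)) ⟩
    v * sum (λ i → indicator (i₀ Fin.≟ i))    ≡⟨ cong (v *_) (sum-indicator i₀) ⟩
    v * 1                                     ≡⟨ ℕ.*-identityʳ v ⟩
    v                                         ∎
    where open ≤-Reasoning

  -- A clique player sees all coordinates but its own, which is expressed as invariance of `g i`
  -- under changes of coordinate `i`.
  CliqueGuess : ℕ → ℕ → Set
  CliqueGuess q d = ∃ λ (g : Fin d → Colouring q d → Fin q) →
    ∀ i c c′ → (∀ j → j ≢ i → lookup c j ≡ lookup c′ j) → g i c ≡ g i c′

  module Cover {q : ℕ} (c₀ : Fin q) (k b : ℕ) .{{_ : NonZero k}} .{{_ : NonZero b}} (b≤k : b ≤ k)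
               (S : Colouring q (k + k) → Bool) (small : ∣ S ∣C < b ^ k) where

    Line : Set
    Line = Fin (k + k) × Colouring q (k + k)

    -- Setting coordinate `i` to `c₀` gives a normal form for the points of a line. The direction is
    -- stored too, since lines in different directions can share this point.
    line : Fin (k + k) → Colouring q (k + k) → Line
    line i x = i , x [ i ]≔ c₀

    _≟Line_ : DecidableEquality Line
    _≟Line_ = ≡-dec Fin._≟_ _≟C_

    -- For the line `(i₀ , z)` only direction `i₀` contributes, and only the points `z [ i₀ ]≔ a`.
    -- Each of them occurs in `A` at most once, so `few-heavies-on-line` applies.
    load : ∀ y A → Unique A → All (λ x → S x ≡ true) A →
           ΣL (λ x → sum (λ i → 𝟙 (heavy b S x i) * indicator (line i x ≟Line y))) A ≤ k
    load (i₀ , z) A unique A⊆S = begin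
      ΣL (λ x → sum (λ i → 𝟙 (heavy b S x i) * indicator (line i x ≟Line (i₀ , z)))) A
        ≤⟨ ΣL-mono A (λ {x} x∈ → sum-single _ i₀ _ (onLine x (All.lookup A⊆S x∈))) ⟩
      ΣL (λ x → sum (λ a → indicator ((z [ i₀ ]≔ a) ≟C x) * weight x)) A
        ≡⟨ sum-ΣL (λ a x → indicator ((z [ i₀ ]≔ a) ≟C x) * weight x) A ⟨
      sum (λ a → ΣL (λ x → indicator ((z [ i₀ ]≔ a) ≟C x) * weight x) A)
        ≤⟨ sum-mono _ _ (λ a → ΣL-point _≟C_ weight (z [ i₀ ]≔ a) A unique) ⟩
      sum (λ a → weight (z [ i₀ ]≔ a))
        ≤⟨ few-heavies-on-line b S z i₀ ⟩
      b
        ≤⟨ b≤k ⟩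
      k ∎
      where
      open ≤-Reasoning
      weight : Colouring q (k + k) → ℕ
      weight x = 𝟙 (S x) * 𝟙 (heavy b S x i₀)

      onLine : ∀ x → S x ≡ true → ∀ i →
               𝟙 (heavy b S x i) * indicator (line i x ≟Line (i₀ , z)) ≤
               sum (λ a → indicator ((z [ i₀ ]≔ a) ≟C x) * weight x) * indicator (i₀ Fin.≟ i)
      onLine x x∈S i with line i x ≟Line (i₀ , z)
      ... | no _ = ℕ.≤-trans (ℕ.≤-reflexive (ℕ.*-zeroʳ (𝟙 (heavy b S x i)))) z≤n
      ... | yes refl rewrite dec-true (i Fin.≟ i) refl = ℕ.*-monoˡ-≤ 1 (begin
          𝟙 (heavy b S x i)     ≡⟨ term≡ ⟨
          term (lookup x i)     ≤⟨ term≤sum term (lookup x i) ⟩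
          sum term              ∎)
        where
        term : Fin q → ℕ
        term a = indicator (((x [ i ]≔ c₀) [ i ]≔ a) ≟C x) * weight x

        term≡ : term (lookup x i) ≡ 𝟙 (heavy b S x i)
        term≡ rewrite dec-true (((x [ i ]≔ c₀) [ i ]≔ lookup x i) ≟C x) (restore x i c₀) | x∈S =
          trans (ℕ.*-identityˡ _) (ℕ.*-identityˡ _)

    index₀ : ∀ {m} .{{_ : NonZero m}} → Fin (m + m)
    index₀ {suc m} = zero

    open SlotMatching _≟C_ _≟Line_ index₀ line (heavy b S) (λ x → S x ≡ true) k
           (many-heavies b S small) load

    members : List (Colouring q (k + k))
    members = filter (λ x → S x Bool.≟ true) (allColourings q (k + k))

    φ-matching : ∃ λ φ → Valid φ (_∈ members)
    φ-matching = matching members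
      (Unique.filter⁺ (λ x → S x Bool.≟ true) (allColourings-unique q (k + k)))
      (All.tabulate (λ x∈ → proj₂ (∈-filter⁻ (λ x → S x Bool.≟ true) {xs = allColourings q (k + k)} x∈)))

    φ = proj₁ φ-matching

    Owner : Line → Colouring q (k + k) → Set
    Owner y x = line (φ x) x ≡ y

    owned? : ∀ y → Dec (Any (Owner y) members)
    owned? y = Any.any? (λ x → line (φ x) x ≟Line y) members

    guess : Fin (k + k) → Colouring q (k + k) → Fin q
    guess i z with owned? (i , z)
    ... | yes any = lookup (proj₁ (find any)) i
    ... | no _    = c₀

    -- Player `φ c` sees a line owned by `c`. Since the matching gives distinct lines to distinct
    -- members, the owner that `guess` finds can only be `c`.
    guess-correct : ∀ c → S c ≡ true → ∃ λ i → guess i (c [ i ]≔ c₀) ≡ lookup c i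
    guess-correct c c∈S = φ c , correct
      where
      c∈ : c ∈ members
      c∈ = ∈-filter⁺ (λ x → S x Bool.≟ true) (∈-allColourings c) c∈S

      correct : guess (φ c) (c [ φ c ]≔ c₀) ≡ lookup c (φ c)
      correct with owned? (line (φ c) c)
      ... | no ∄ = contradiction (lose c∈ refl) ∄
      ... | yes any with find any
      ...   | x , x∈ , eq = cong (λ y → lookup y (φ c))
                              (proj₂ (proj₂ φ-matching) x c x∈ c∈ eq)

  cover : ∀ {q} → Fin q → ∀ k b .{{_ : NonZero k}} .{{_ : NonZero b}} → b ≤ k →
          (S : Colouring q (k + k) → Bool) → ∣ S ∣C < b ^ k →
          ∃ λ ((g , _) : CliqueGuess q (k + k)) → ∀ c → S c ≡ true → ∃ λ i → g i c ≡ lookup c i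
  cover c₀ k b b≤k S small =
    -- Player `i` receives the colouring with its own coordinate overwritten, whence the invariance.
    ((λ i c → guess i (c [ i ]≔ c₀)) , λ i c c′ off → cong (guess i) (≔-cong c c′ i c₀ off))
    , guess-correct
    where open Cover c₀ k b b≤k S small

  -- Functions excluding many points

  ΣC-+ : ∀ {q n} (f g : Colouring q n → ℕ) → ΣC (λ c → f c + g c) ≡ ΣC f + ΣC g
  ΣC-+ {n = zero}  f g = refl
  ΣC-+ {n = suc n} f g =
    trans (sum-cong-≗ (λ a → ΣC-+ (f ∘ (a ∷_)) (g ∘ (a ∷_)))) (∑-distrib-+ (λ a → ΣC (f ∘ (a ∷_))) (λ a → ΣC (g ∘ (a ∷_))))

  ΣC-const : ∀ q n k → ΣC {q} {n} (λ _ → k) ≡ k * q ^ n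
  ΣC-const q zero    k = sym (ℕ.*-identityʳ k)
  ΣC-const q (suc n) k = trans (sum-cong-≗ {q} (λ _ → ΣC-const q n k))
    (trans (sum-const q _) (rearrange q k (q ^ n)))
    where
    rearrange : ∀ q k m → q * (k * m) ≡ k * (q * m)
    rearrange = solve-∀

  ΣC-* : ∀ {q n} k (f : Colouring q n → ℕ) → ΣC (λ c → k * f c) ≡ k * ΣC f
  ΣC-* {n = zero}  k f = refl
  ΣC-* {n = suc n} k f =
    trans (sum-cong-≗ (λ a → ΣC-* k (f ∘ (a ∷_)))) (sum-* k (λ a → ΣC (f ∘ (a ∷_))))

  ΣC-ΣL : ∀ {q n} {X : Set} (f : X → Colouring q n → ℕ) xs →
          ΣC (λ c → ΣL (λ x → f x c) xs) ≡ ΣL (λ x → ΣC (f x)) xs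
  ΣC-ΣL {q} {n} f [] = ΣC-const q n 0
  ΣC-ΣL f (x ∷ xs) = trans (ΣC-+ (f x) _) (cong (ΣC (f x) +_) (ΣC-ΣL f xs))

  ΣL-* : ∀ {X : Set} k (f : X → ℕ) xs → ΣL (λ x → k * f x) xs ≡ k * ΣL f xs
  ΣL-* k f []       = sym (ℕ.*-zeroʳ k)
  ΣL-* k f (x ∷ xs) = trans (cong (k * f x +_) (ΣL-* k f xs)) (sym (ℕ.*-distribˡ-+ k (f x) _))

  average-Fin : ∀ {n} .{{_ : NonZero n}} (f : Fin n → ℕ) B → sum f ≤ n * B → ∃ λ i → f i ≤ B
  average-Fin {n} f B small with Fin.any? (λ i → f i ≤? B)
  ... | yes found = found
  ... | no none   = contradiction small (ℕ.<⇒≱ (begin-strict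
    n * B                <⟨ ℕ.*-monoʳ-< n (ℕ.n<1+n B) ⟩
    n * suc B            ≡⟨ sum-const n (suc B) ⟨
    sum {n} (λ _ → suc B) ≤⟨ sum-mono _ f (λ i → ℕ.≰⇒> (λ le → none (i , le))) ⟩
    sum f                ∎))
    where open ≤-Reasoning

  average : ∀ {q n} .{{_ : NonZero q}} (f : Colouring q n → ℕ) B → ΣC f ≤ B * q ^ n → ∃ λ c → f c ≤ B
  average {q} {zero}  f B small = [] , ℕ.≤-trans small (ℕ.≤-reflexive (ℕ.*-identityʳ B))
  average {q} {suc n} f B small =
    let (a , small′) = average-Fin _ (B * q ^ n)
                         (ℕ.≤-trans small (ℕ.≤-reflexive (rearrange B q (q ^ n))))
        (c , fc≤B)   = average (f ∘ (a ∷_)) B small′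
    in a ∷ c , fc≤B
    where
    rearrange : ∀ B q m → B * (q * m) ≡ q * (B * m)
    rearrange = solve-∀

  Subset : ℕ → Set
  Subset = Vec Bool

  size : ∀ {M} → Subset M → ℕ
  size T = sum (𝟙 ∘ lookup T)

  avoids : ∀ {q M} → Subset M → Colouring q M → Fin q → Bool
  avoids []          []      a = true
  avoids (false ∷ T) (x ∷ f) a = avoids T f a
  avoids (true ∷ T)  (x ∷ f) a = not (does (a Fin.≟ x)) ∧ avoids T f a

  avoids-true : ∀ {q M} (T : Subset M) (f : Colouring q M) a →
                (∀ i → lookup T i ≡ true → lookup f i ≢ a) → avoids T f a ≡ true
  avoids-true []          []      a h = refl
  avoids-true (false ∷ T) (x ∷ f) a h = avoids-true T f a (λ i → h (suc i))
  avoids-true (true ∷ T)  (x ∷ f) a h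
    rewrite dec-false (a Fin.≟ x) (λ a≡x → h zero refl (sym a≡x)) = avoids-true T f a (λ i → h (suc i))

  sum-other : ∀ {p} (a : Fin (suc p)) → sum (λ x → 𝟙 (not (does (a Fin.≟ x)))) ≡ p
  sum-other {p} a = ℕ.+-cancelˡ-≡ 1 _ _
    (trans (cong (_+ sum (λ x → 𝟙 (not (does (a Fin.≟ x))))) (sym (sum-indicator a)))
           (heavies+lights (λ x → does (a Fin.≟ x))))

  𝟙-∧ : ∀ u v → 𝟙 (u ∧ v) ≡ 𝟙 v * 𝟙 u
  𝟙-∧ true  true  = refl
  𝟙-∧ true  false = refl
  𝟙-∧ false true  = refl
  𝟙-∧ false false = refl

  -- For uniform `f`, the `size T` values on `T` independently differ from `a` with probability
  -- p/(p+1); this is the resulting product with denominators cleared.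
  avoid-count : ∀ {p M} (T : Subset M) (a : Fin (suc p)) →
                suc p ^ size T * ΣC (λ f → 𝟙 (avoids T f a)) ≡ p ^ size T * suc p ^ M
  avoid-count []          a = refl
  avoid-count {p} {suc M} (false ∷ T) a = begin-equality
    suc p ^ t * sum {suc p} (λ x → C)    ≡⟨ cong (suc p ^ t *_) (sum-const (suc p) C) ⟩
    suc p ^ t * (suc p * C)              ≡⟨ rearrange (suc p ^ t) (suc p) C ⟩
    suc p * (suc p ^ t * C)              ≡⟨ cong (suc p *_) (avoid-count T a) ⟩
    suc p * (p ^ t * suc p ^ M)          ≡⟨ rearrange (suc p) (p ^ t) _ ⟩
    p ^ t * (suc p * suc p ^ M)          ∎
    where
    open ≤-Reasoning
    t = size T
    C = ΣC (λ f → 𝟙 (avoids T f a))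
    rearrange : ∀ x y z → x * (y * z) ≡ y * (x * z)
    rearrange = solve-∀
  avoid-count {p} {suc M} (true ∷ T) a = begin-equality
    suc p * suc p ^ t * sum (λ x → ΣC (λ f → 𝟙 (not (does (a Fin.≟ x)) ∧ avoids T f a)))
      ≡⟨ cong (suc p * suc p ^ t *_) (sum-cong-≗ (λ x → ΣC-cong _ _ (λ f → trans
           (𝟙-∧ (not (does (a Fin.≟ x))) (avoids T f a)) (ℕ.*-comm (𝟙 (avoids T f a)) _)))) ⟩
    suc p * suc p ^ t * sum (λ x → ΣC (λ f → 𝟙 (not (does (a Fin.≟ x))) * 𝟙 (avoids T f a)))
      ≡⟨ cong (suc p * suc p ^ t *_) (sum-cong-≗ (λ x → trans
           (ΣC-* (𝟙 (not (does (a Fin.≟ x)))) (λ f → 𝟙 (avoids T f a)))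
           (ℕ.*-comm (𝟙 (not (does (a Fin.≟ x)))) C))) ⟩
    suc p * suc p ^ t * sum (λ x → C * 𝟙 (not (does (a Fin.≟ x))))
      ≡⟨ cong (suc p * suc p ^ t *_) (trans (sum-* C (λ x → 𝟙 (not (does (a Fin.≟ x))))) (cong (C *_) (sum-other a))) ⟩
    suc p * suc p ^ t * (C * p)            ≡⟨ rearrange (suc p) (suc p ^ t) C p ⟩
    suc p * p * (suc p ^ t * C)            ≡⟨ cong (suc p * p *_) (avoid-count T a) ⟩
    suc p * p * (p ^ t * suc p ^ M)        ≡⟨ rearrange′ (suc p) p (p ^ t) (suc p ^ M) ⟩
    p * p ^ t * (suc p * suc p ^ M)        ∎
    where
    open ≤-Reasoning
    t = size T
    C = ΣC (λ f → 𝟙 (avoids T f a))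
    rearrange : ∀ q x C p → q * x * (C * p) ≡ q * p * (x * C)
    rearrange = solve-∀
    rearrange′ : ∀ q p x y → q * p * (x * y) ≡ p * x * (q * y)
    rearrange′ = solve-∀

  -- It vanishes exactly when `f` maps `T` onto the whole set of colours, the property that
  -- `shattering` aims at.
  missed : ∀ {q M} → Subset M → Colouring q M → ℕ
  missed T f = sum (λ a → 𝟙 (avoids T f a))

  missed-total : ∀ {p M} (T : Subset M) →
    suc p ^ size T * ΣC {suc p} (missed T) ≡ suc p * p ^ size T * suc p ^ M
  missed-total {p} {M} T = begin-equality
    suc p ^ t * ΣC {suc p} (missed T)
      ≡⟨ cong (suc p ^ t *_) (ΣC-sum (λ a f → 𝟙 (avoids T f a))) ⟩
    suc p ^ t * sum (λ a → ΣC (λ f → 𝟙 (avoids T f a)))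
      ≡⟨ sum-* (suc p ^ t) (λ a → ΣC (λ f → 𝟙 (avoids T f a))) ⟨
    sum (λ a → suc p ^ t * ΣC (λ f → 𝟙 (avoids T f a)))
      ≡⟨ sum-cong-≗ (avoid-count {p} T) ⟩
    sum {suc p} (λ _ → p ^ t * suc p ^ M)
      ≡⟨ sum-const (suc p) _ ⟩
    suc p * (p ^ t * suc p ^ M)
      ≡⟨ ℕ.*-assoc (suc p) (p ^ t) _ ⟨
    suc p * p ^ t * suc p ^ M ∎
    where
    open ≤-Reasoning
    t = size T

  -- The functions f are chosen one after the other, each keeping the weighted
  -- number of sets that are not yet hit at or below its average.
  shattering : ∀ {p M} t N (𝓛 : List (Subset M)) → (∀ {T} → T ∈ 𝓛 → size T ≡ t) → (μ : Subset M → ℕ) →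
    ΣL μ 𝓛 * (suc p * p ^ t) ^ N < (suc p ^ t) ^ N →
    ∃ λ (F : Vec (Colouring (suc p) M) N) →
      ∀ {T} → T ∈ 𝓛 → μ T ≡ 0 ⊎ ∃ λ w → missed T (lookup F w) ≡ 0
  -- With no function left to choose, the total weight is below 1, so all weights are 0.
  shattering t zero 𝓛 sizes μ small = [] , λ T∈ → inj₁ (ℕ.n<1⇒n≡0 (ℕ.≤-<-trans (term≤ΣL μ T∈)
    (subst (_< 1) (ℕ.*-identityʳ _) small)))
  shattering {p} {M} t (suc N) 𝓛 sizes μ small =
    let (f , few) = average {suc p} {M} potential (suc p * p ^ t * ΣL μ 𝓛) total
        -- The new weight of `T` becomes 0 once some chosen `f` attains every colour on `T`.
        -- Averaged over `f`, the total weight is multiplied by q(p/q)^t.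
        (F , hit) = shattering t N 𝓛 sizes (λ T → μ T * missed T f) (rest f few)
    in f ∷ F , λ {T} T∈ → combine-hits f F T (hit T∈)
    where
    open ≤-Reasoning
    q = suc p

    -- The factor `q ^ t` clears the denominator of (p/q)^t.
    potential : Colouring q M → ℕ
    potential f = q ^ t * ΣL (λ T → μ T * missed T f) 𝓛

    share : ∀ {T} → T ∈ 𝓛 → q ^ t * ΣC (λ f → μ T * missed T f) ≤ q * p ^ t * q ^ M * μ T
    share {T} T∈ = begin
      q ^ t * ΣC (λ f → μ T * missed T f)   ≡⟨ cong (q ^ t *_) (ΣC-* (μ T) (missed T)) ⟩
      q ^ t * (μ T * ΣC (missed T))         ≡⟨ swap (q ^ t) (μ T) (ΣC (missed T)) ⟩
      q ^ t * ΣC (missed T) * μ T           ≡⟨ cong (λ s → q ^ s * ΣC (missed T) * μ T) (sizes T∈) ⟨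
      q ^ size T * ΣC (missed T) * μ T      ≡⟨ cong (_* μ T) (missed-total {p} T) ⟩
      q * p ^ size T * q ^ M * μ T          ≡⟨ cong (λ s → q * p ^ s * q ^ M * μ T) (sizes T∈) ⟩
      q * p ^ t * q ^ M * μ T               ∎
      where
      swap : ∀ x y z → x * (y * z) ≡ x * z * y
      swap = solve-∀

    total : ΣC potential ≤ q * p ^ t * ΣL μ 𝓛 * q ^ M
    total = begin
      ΣC potential                                           ≡⟨ ΣC-* (q ^ t) (λ f → ΣL (λ T → μ T * missed T f) 𝓛) ⟩
      q ^ t * ΣC (λ f → ΣL (λ T → μ T * missed T f) 𝓛)       ≡⟨ cong (q ^ t *_) (ΣC-ΣL (λ T f → μ T * missed T f) 𝓛) ⟩
      q ^ t * ΣL (λ T → ΣC (λ f → μ T * missed T f)) 𝓛       ≡⟨ ΣL-* (q ^ t) _ 𝓛 ⟨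
      ΣL (λ T → q ^ t * ΣC (λ f → μ T * missed T f)) 𝓛       ≤⟨ ΣL-mono 𝓛 share ⟩
      ΣL (λ T → q * p ^ t * q ^ M * μ T) 𝓛                   ≡⟨ ΣL-* (q * p ^ t * q ^ M) μ 𝓛 ⟩
      q * p ^ t * q ^ M * ΣL μ 𝓛                             ≡⟨ swap (q * p ^ t) (q ^ M) (ΣL μ 𝓛) ⟩
      q * p ^ t * ΣL μ 𝓛 * q ^ M                             ∎
      where
      swap : ∀ x y z → x * y * z ≡ x * z * y
      swap = solve-∀

    rest : ∀ f → potential f ≤ q * p ^ t * ΣL μ 𝓛 →
           ΣL (λ T → μ T * missed T f) 𝓛 * (q * p ^ t) ^ N < (q ^ t) ^ N
    rest f few = ℕ.*-cancelˡ-< (q ^ t) _ _ (begin-strict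
      q ^ t * (μ′ * (q * p ^ t) ^ N)         ≡⟨ ℕ.*-assoc (q ^ t) μ′ _ ⟨
      q ^ t * μ′ * (q * p ^ t) ^ N           ≤⟨ ℕ.*-monoˡ-≤ _ few ⟩
      q * p ^ t * ΣL μ 𝓛 * (q * p ^ t) ^ N   ≡⟨ swap (q * p ^ t) (ΣL μ 𝓛) _ ⟩
      ΣL μ 𝓛 * (q * p ^ t) ^ suc N           <⟨ small ⟩
      q ^ t * (q ^ t) ^ N                    ∎)
      where
      μ′ = ΣL (λ T → μ T * missed T f) 𝓛
      swap : ∀ x y z → x * y * z ≡ y * (x * z)
      swap = solve-∀

    combine-hits : ∀ f F T → μ T * missed T f ≡ 0 ⊎ (∃ λ w → missed T (lookup F w) ≡ 0) →
                   μ T ≡ 0 ⊎ ∃ λ w → missed T (lookup (f ∷ F) w) ≡ 0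
    combine-hits f F T (inj₂ (w , eq)) = inj₂ (suc w , eq)
    combine-hits f F T (inj₁ eq) with ℕ.m*n≡0⇒m≡0∨n≡0 (μ T) eq
    ... | inj₁ μ≡0 = inj₁ μ≡0
    ... | inj₂ missed≡0 = inj₂ (zero , missed≡0)

  subsets : ∀ M → ℕ → List (Subset M)
  subsets zero    zero    = [] ∷ []
  subsets zero    (suc t) = []
  subsets (suc M) zero    = map (false ∷_) (subsets M zero)
  subsets (suc M) (suc t) = map (false ∷_) (subsets M (suc t)) ++ map (true ∷_) (subsets M t)

  ∈-subsets⇒size : ∀ M t {T} → T ∈ subsets M t → size T ≡ t
  ∈-subsets⇒size zero zero (here refl) = refl
  ∈-subsets⇒size (suc M) zero T∈ with ∈-map⁻ (false ∷_) T∈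
  ... | T′ , T′∈ , refl = ∈-subsets⇒size M zero T′∈
  ∈-subsets⇒size (suc M) (suc t) T∈ with ∈-++⁻ (map (false ∷_) (subsets M (suc t))) T∈
  ... | inj₁ T∈₁ with ∈-map⁻ (false ∷_) T∈₁
  ...   | T′ , T′∈ , refl = ∈-subsets⇒size M (suc t) T′∈
  ∈-subsets⇒size (suc M) (suc t) T∈ | inj₂ T∈₂ with ∈-map⁻ (true ∷_) T∈₂
  ...   | T′ , T′∈ , refl = cong suc (∈-subsets⇒size M t T′∈)

  length-subsets : ∀ M t → length (subsets M t) ≤ M ^ t
  length-subsets zero    zero    = ℕ.≤-refl
  length-subsets zero    (suc t) = z≤n
  length-subsets (suc M) zero    =
    ℕ.≤-trans (ℕ.≤-reflexive (length-map (false ∷_) (subsets M zero))) (length-subsets M zero)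
  length-subsets (suc M) (suc t) = begin
    length (map (false ∷_) (subsets M (suc t)) ++ map (true ∷_) (subsets M t))
      ≡⟨ length-++ (map (false ∷_) (subsets M (suc t))) ⟩
    length (map (false ∷_) (subsets M (suc t))) + length (map (true ∷_) (subsets M t))
      ≡⟨ cong₂ _+_ (length-map (false ∷_) (subsets M (suc t))) (length-map (true ∷_) (subsets M t)) ⟩
    length (subsets M (suc t)) + length (subsets M t)
      ≤⟨ ℕ.+-mono-≤ (length-subsets M (suc t)) (length-subsets M t) ⟩
    M * M ^ t + M ^ t
      ≡⟨ ℕ.+-comm (M * M ^ t) (M ^ t) ⟩
    suc M * M ^ t
      ≤⟨ ℕ.*-monoʳ-≤ (suc M) (ℕ.^-monoˡ-≤ t (ℕ.n≤1+n M)) ⟩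
    suc M * suc M ^ t ∎
    where open ≤-Reasoning

  subset-of-size : ∀ M t (S : Fin M → Bool) → t ≤ sum (𝟙 ∘ S) →
                   ∃ λ T → T ∈ subsets M t × (∀ i → lookup T i ≡ true → S i ≡ true)
  subset-of-size zero    zero    S t≤ = [] , here refl , λ ()
  subset-of-size (suc M) zero    S t≤ =
    let (T , T∈ , T⊆S) = subset-of-size M zero (S ∘ suc) z≤n
    in false ∷ T , ∈-map⁺ (false ∷_) T∈ , λ { (suc i) → T⊆S i }
  subset-of-size (suc M) (suc t) S t≤ with S zero in S₀
  ... | false =
    let (T , T∈ , T⊆S) = subset-of-size M (suc t) (S ∘ suc) t≤
    in false ∷ T , ∈-++⁺ˡ (∈-map⁺ (false ∷_) T∈) , λ { (suc i) → T⊆S i }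
  ... | true =
    let (T , T∈ , T⊆S) = subset-of-size M t (S ∘ suc) (ℕ.≤-pred t≤)
    in true ∷ T , ∈-++⁺ʳ (map (false ∷_) (subsets M (suc t))) (∈-map⁺ (true ∷_) T∈)
     , λ { zero _ → S₀ ; (suc i) → T⊆S i }

  -- `shattering` is applied to all sets of size `N`, at most `M ^ N` in number. If `N` points were
  -- excluded by all functions, some `F w` would attain every colour on these points, among them
  -- `c w`.
  excluding-functions : ∀ p M N → M ^ N * (suc p * p ^ N) ^ N < (suc p ^ N) ^ N →
    ∃ λ (F : Vec (Colouring (suc p) M) N) → ∀ (c : Fin N → Fin (suc p)) (S : Fin M → Bool) →
      (∀ w i → S i ≡ true → lookup (lookup F w) i ≢ c w) → sum (𝟙 ∘ S) < N
  excluding-functions p M N small = F , few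
    where
    open ≤-Reasoning
    enough : ΣL (λ _ → 1) (subsets M N) * (suc p * p ^ N) ^ N < (suc p ^ N) ^ N
    enough = begin-strict
      ΣL (λ _ → 1) (subsets M N) * (suc p * p ^ N) ^ N
        ≡⟨ cong (_* (suc p * p ^ N) ^ N) (trans (ΣL-const 1 (subsets M N)) (ℕ.*-identityʳ (length (subsets M N)))) ⟩
      length (subsets M N) * (suc p * p ^ N) ^ N
        ≤⟨ ℕ.*-monoˡ-≤ _ (length-subsets M N) ⟩
      M ^ N * (suc p * p ^ N) ^ N
        <⟨ small ⟩
      (suc p ^ N) ^ N ∎

    shattered = shattering N N (subsets M N) (∈-subsets⇒size M N) (λ _ → 1) enough
    F = proj₁ shattered

    few : ∀ (c : Fin N → Fin (suc p)) (S : Fin M → Bool) →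
          (∀ w i → S i ≡ true → lookup (lookup F w) i ≢ c w) → sum (𝟙 ∘ S) < N
    few c S excluded with N ≤? sum (𝟙 ∘ S)
    ... | no N≰ = ℕ.≰⇒> N≰
    ... | yes N≤ with subset-of-size M N S N≤
    ...   | T , T∈ , T⊆S with proj₂ shattered T∈
    ...     | inj₂ (w , missed≡0) = contradiction (begin
        1                                     ≡⟨ cong 𝟙 (avoids-true T (lookup F w) (c w) (λ i i∈ → excluded w i (T⊆S i i∈))) ⟨
        𝟙 (avoids T (lookup F w) (c w))       ≤⟨ term≤sum (λ a → 𝟙 (avoids T (lookup F w) a)) (c w) ⟩
        missed T (lookup F w)                 ≡⟨ missed≡0 ⟩
        0                                     ∎) λ ()

  -- Numbering the colourings of the spine

  sum-↑ : ∀ m {n} (f : Fin (m + n) → ℕ) → sum f ≡ sum (f ∘ (_↑ˡ n)) + sum (f ∘ (m ↑ʳ_))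
  sum-↑ zero    f = refl
  sum-↑ (suc m) f = trans (cong (f zero +_) (sum-↑ m (f ∘ suc))) (sym (ℕ.+-assoc (f zero) _ _))

  sum-combine : ∀ m {n} (f : Fin (m * n) → ℕ) → sum f ≡ sum (λ i → sum (λ j → f (combine {m} i j)))
  sum-combine zero    f = refl
  sum-combine (suc m) {n} f = trans (sum-↑ n f) (cong (sum (f ∘ (_↑ˡ (m * n))) +_) (sum-combine m (f ∘ (n ↑ʳ_))))

  encode : ∀ {q d} → Colouring q d → Fin (q ^ d)
  encode []      = zero
  encode (a ∷ c) = combine a (encode c)

  ΣC-encode : ∀ {q} d (f : Fin (q ^ d) → ℕ) → ΣC (λ c → f (encode {q} {d} c)) ≡ sum f
  ΣC-encode     zero    f = sym (ℕ.+-identityʳ (f zero))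
  ΣC-encode {q} (suc d) f =
    trans (sum-cong-≗ {q} (λ a → ΣC-encode {q} d (λ j → f (combine a j)))) (sym (sum-combine q f))

  -- The number of functions that suffices

  -- Bernoulli's inequality 1 + j/p ≤ (1 + 1/p)^j, multiplied by p^(j+1).
  bernoulli : ∀ p j → p ^ j * (p + j) ≤ p * suc p ^ j
  bernoulli p zero    = ℕ.≤-reflexive (trans (ℕ.*-identityˡ _) (trans (ℕ.+-identityʳ p) (sym (ℕ.*-identityʳ p))))
  bernoulli p (suc j) = begin
    p * p ^ j * (p + suc j)           ≡⟨ lhs p (p ^ j) j ⟩
    p ^ j * (p * (p + suc j))         ≤⟨ ℕ.*-monoʳ-≤ (p ^ j) (ℕ.m≤m+n _ j) ⟩
    p ^ j * (p * (p + suc j) + j)     ≡⟨ middle p (p ^ j) j ⟩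
    suc p * (p ^ j * (p + j))         ≤⟨ ℕ.*-monoʳ-≤ (suc p) (bernoulli p j) ⟩
    suc p * (p * suc p ^ j)           ≡⟨ rhs (suc p) p (suc p ^ j) ⟩
    p * (suc p * suc p ^ j)           ∎
    where
    open ≤-Reasoning
    lhs : ∀ p x j → p * x * (p + suc j) ≡ x * (p * (p + suc j))
    lhs = solve-∀
    middle : ∀ p x j → x * (p * (p + suc j) + j) ≡ suc p * (x * (p + j))
    middle = solve-∀
    rhs : ∀ q p x → q * (p * x) ≡ p * (q * x)
    rhs = solve-∀

  -- (1 + 1/p)^(p+1) ≥ 2
  2*p^suc-p≤ : ∀ p .{{_ : NonZero p}} → 2 * p ^ suc p ≤ suc p ^ suc p
  2*p^suc-p≤ p = begin
    2 * (p * p ^ p)     ≡⟨ swap p (p ^ p) ⟩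
    p * (2 * p ^ p)     ≤⟨ ℕ.*-mono-≤ (ℕ.n≤1+n p) twice ⟩
    suc p * suc p ^ p   ∎
    where
    open ≤-Reasoning
    swap : ∀ p x → 2 * (p * x) ≡ p * (2 * x)
    swap = solve-∀
    swap′ : ∀ p x → p * (2 * x) ≡ x * (p + p)
    swap′ = solve-∀
    twice : 2 * p ^ p ≤ suc p ^ p
    twice = ℕ.*-cancelˡ-≤ p (begin
      p * (2 * p ^ p)     ≡⟨ swap′ p (p ^ p) ⟩
      p ^ p * (p + p)     ≤⟨ bernoulli p p ⟩
      p * suc p ^ p       ∎)

  ^-distrib-* : ∀ x y n → (x * y) ^ n ≡ x ^ n * y ^ n
  ^-distrib-* x y zero    = refl
  ^-distrib-* x y (suc n) = trans (cong (x * y *_) (^-distrib-* x y n)) (swap x y (x ^ n) (y ^ n))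
    where
    swap : ∀ x y u v → x * y * (u * v) ≡ x * u * (y * v)
    swap = solve-∀

  -- Write q for `suc p`. After taking N-th roots the claim is q^(d+1) (p/q)^N < 1. Since (p/q)^q ≤
  -- 1/2 and N = qm, the second factor is at most 2^(-m).
  few-functions-suffice : ∀ p m d .{{_ : NonZero p}} → suc p ^ suc d < 2 ^ m → let N = suc p * m in
    (suc p ^ d) ^ N * (suc p * p ^ N) ^ N < (suc p ^ N) ^ N
  few-functions-suffice p zero d big =
    contradiction big (ℕ.≤⇒≯ (ℕ.m^n>0 (suc p) (suc d)))
  few-functions-suffice p m@(suc _) d big = begin-strict
    (q ^ d) ^ N * (q * p ^ N) ^ N   ≡⟨ ^-distrib-* (q ^ d) (q * p ^ N) N ⟨
    (q ^ d * (q * p ^ N)) ^ N       <⟨ ℕ.^-monoˡ-< N base ⟩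
    (q ^ N) ^ N                     ∎
    where
    open ≤-Reasoning
    q = suc p
    N = q * m
    swap : ∀ x q y → x * (q * y) ≡ q * x * y
    swap = solve-∀
    base : q ^ d * (q * p ^ N) < q ^ N
    base = begin-strict
      q ^ d * (q * p ^ N)    ≡⟨ swap (q ^ d) q (p ^ N) ⟩
      q ^ suc d * p ^ N      <⟨ ℕ.*-monoˡ-< (p ^ N) {{ℕ.m^n≢0 p N}} big ⟩
      2 ^ m * p ^ N          ≡⟨ cong (2 ^ m *_) (ℕ.^-*-assoc p q m) ⟨
      2 ^ m * (p ^ q) ^ m    ≡⟨ ^-distrib-* 2 (p ^ q) m ⟨
      (2 * p ^ q) ^ m        ≤⟨ ℕ.^-monoˡ-≤ m (2*p^suc-p≤ p) ⟩
      (q ^ q) ^ m            ≡⟨ ℕ.^-*-assoc q q m ⟩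
      q ^ N                  ∎

  -- Playing on a book

  open Graph

  does-sound : ∀ {P : Set} (P? : Dec P) → does P? ≡ true → P
  does-sound (yes p) _ = p

  module Localised {n q} (G : Graph n) (c₀ : Fin q) where

    colourIn : (vs : List (Fin n)) → Vec (Fin q) (length vs) → Fin n → Fin q
    colourIn []       []       u = c₀
    colourIn (v ∷ vs) (x ∷ xs) u = if does (u Fin.≟ v) then x else colourIn vs xs u

    colourIn-map : ∀ (c : Colouring q n) (vs : List (Fin n)) {u} → u ∈ vs →
                   colourIn vs (Vec.map (lookup c) (fromList vs)) u ≡ lookup c u
    colourIn-map c (v ∷ vs) {u} u∈ with u Fin.≟ v
    ... | yes refl = refl
    colourIn-map c (v ∷ vs) (here u≡v)  | no u≢v = contradiction u≡v u≢v
    colourIn-map c (v ∷ vs) (there u∈)  | no u≢v = colourIn-map c vs u∈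

    -- A player fills the colours it does not see with `c₀` before applying `g`; by locality this
    -- does not change the guess.
    localised : (g : Fin n → Colouring q n → Fin q) →
                (∀ w c c′ → (∀ v → adj G w v ≡ true → lookup c v ≡ lookup c′ v) → g w c ≡ g w c′) →
                (∀ c → ∃ λ w → g w c ≡ lookup c w) → Winnable G q
    localised g local win = strategy , wins
      where
      completion : ∀ w → Vec (Fin q) (degree G w) → Colouring q n
      completion w v = tabulate (colourIn (neighbours G w) v)

      strategy : Strategy G q
      strategy w v = g w (completion w v)

      same : ∀ c w v → adj G w v ≡ true → lookup (completion w (view G c w)) v ≡ lookup c v
      same c w v adjacent = trans (Vec.lookup∘tabulate _ v)
        (colourIn-map c (neighbours G w)
          (∈-filter⁺ (λ v → T? (adj G w v)) (∈-allFin v) (Equivalence.from T-≡ adjacent)))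

      wins : Winning G strategy
      wins c = let (w , correct) = win c in
        w , trans (local w (completion w (view G c w)) c (same c w)) correct

  open Localised using (localised)

  -- Injectivity is a field for the pages alone: adjacency and irreflexivity make the spine
  -- injective and disjoint from the pages.
  record Book {n} (G : Graph n) (d N : ℕ) : Set where
    field
      spine          : Fin d → Fin n
      page           : Fin N → Fin n
      spine-adj      : ∀ i j → i ≢ j → adj G (spine i) (spine j) ≡ true
      page-adj       : ∀ w i → adj G (page w) (spine i) ≡ true
      page-injective : ∀ w w′ → page w ≡ page w′ → w ≡ w′

    loopless : ∀ {u v} → adj G u v ≡ true → u ≢ v
    loopless {u} adjacent refl with trans (sym (irreflexive G u)) adjacent
    ... | ()

    spine-injective : ∀ i j → spine i ≡ spine j → i ≡ j
    spine-injective i j eq =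
      decidable-stable (i Fin.≟ j) (λ i≢j → loopless (spine-adj i j i≢j) eq)

  module BookStrategy
    {n} (G : Graph n) {k N p b} .{{_ : NonZero k}} .{{_ : NonZero b}} (b≤k : b ≤ k)
    (book : Book G (k + k) N) (N≤b^k : N ≤ b ^ k)
    (F : Vec (Colouring (suc p) (suc p ^ (k + k))) N)
    (F-excludes : ∀ (c : Fin N → Fin (suc p)) (S : Fin (suc p ^ (k + k)) → Bool) →
       (∀ w i → S i ≡ true → lookup (lookup F w) i ≢ c w) → sum (𝟙 ∘ S) < N)
    where

    open Book book
    q = suc p
    d = k + k

    pageGuess : Fin N → Colouring q d → Fin q
    pageGuess w x = lookup (lookup F w) (encode x)

    excluded? : ∀ (y : Colouring q N) i → Dec (∀ w → lookup (lookup F w) i ≢ lookup y w)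
    excluded? y i = Fin.all? (λ w → ¬? (lookup (lookup F w) i Fin.≟ lookup y w))

    unguessed : Colouring q N → Colouring q d → Bool
    unguessed y x = does (excluded? y (encode x))

    unguessed-few : ∀ y → ∣ unguessed y ∣C < b ^ k
    unguessed-few y = ℕ.<-≤-trans (ℕ.≤-<-trans
      (ℕ.≤-reflexive (ΣC-encode d (λ i → 𝟙 (does (excluded? y i)))))
      (F-excludes (lookup y) (does ∘ excluded? y)
         (λ w i i∈ → does-sound (excluded? y i) i∈ w))) N≤b^k

    covering : ∀ y → ∃ λ ((g , _) : CliqueGuess q d) → ∀ x → unguessed y x ≡ true →
               ∃ λ i → g i x ≡ lookup x i
    covering y = cover zero k b b≤k (unguessed y) (unguessed-few y)

    -- Every spine vertex is adjacent to all pages, so they all know `y` and can follow the same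
    -- cover, chosen for this `y`.
    spineGuess : Colouring q N → Fin d → Colouring q d → Fin q
    spineGuess y = proj₁ (proj₁ (covering y))

    spineColours : Colouring q n → Colouring q d
    spineColours c = tabulate (lookup c ∘ spine)

    pageColours : Colouring q n → Colouring q N
    pageColours c = tabulate (lookup c ∘ page)

    Spine Page : Fin n → Set
    Spine v = ∃ λ i → spine i ≡ v
    Page v = ∃ λ w → page w ≡ v

    -- The decisions are arguments so that the following lemmas can split on them. Vertices outside
    -- the book guess `zero`.
    play : ∀ {v} → Dec (Spine v) → Dec (Page v) → Colouring q n → Fin q
    play (yes (i , _)) _             c = spineGuess (pageColours c) i (spineColours c)
    play (no _)        (yes (w , _)) c = pageGuess w (spineColours c)
    play (no _)        (no _)        c = zero

    spine? : ∀ v → Dec (Spine v)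
    spine? v = Fin.any? (λ i → spine i Fin.≟ v)

    page? : ∀ v → Dec (Page v)
    page? v = Fin.any? (λ w → page w Fin.≟ v)

    play-local : ∀ {v} (s : Dec (Spine v)) (r : Dec (Page v)) c c′ →
                 (∀ u → adj G v u ≡ true → lookup c u ≡ lookup c′ u) → play s r c ≡ play s r c′
    -- The cover is chosen by the page colours, so these are identified first; then the invariance
    -- of a single cover applies.
    play-local (yes (i , refl)) _ c c′ agree
      rewrite Vec.tabulate-cong {f = lookup c ∘ page} {g = lookup c′ ∘ page}
                (λ w → agree (page w) (trans (symmetric G (spine i) (page w)) (page-adj w i))) =
      proj₂ (proj₁ (covering (pageColours c′))) i (spineColours c) (spineColours c′)
        (λ j j≢i → trans (Vec.lookup∘tabulate _ j)
          (trans (agree (spine j) (spine-adj i j (j≢i ∘ sym))) (sym (Vec.lookup∘tabulate _ j))))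
    play-local (no _) (yes (w , refl)) c c′ agree =
      cong (pageGuess w) (Vec.tabulate-cong (λ i → agree (spine i) (page-adj w i)))
    play-local (no _) (no _) c c′ agree = refl

    play-spine : ∀ i (s : Dec (Spine (spine i))) r c →
                 play s r c ≡ spineGuess (pageColours c) i (spineColours c)
    play-spine i (yes (j , eq)) r c rewrite spine-injective j i eq = refl
    play-spine i (no ∄)         r c = contradiction (i , refl) ∄

    play-page : ∀ w (s : Dec (Spine (page w))) (r : Dec (Page (page w))) c →
                play s r c ≡ pageGuess w (spineColours c)
    play-page w (yes (i , eq)) r c = contradiction (sym eq) (loopless (page-adj w i))
    play-page w (no _) (yes (w′ , eq)) c rewrite page-injective w′ w eq = refl
    play-page w (no _) (no ∄) c = contradiction (w , refl) ∄

    wins : ∀ c → ∃ λ v → play (spine? v) (page? v) c ≡ lookup c v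
    wins c with excluded? (pageColours c) (encode (spineColours c)) in unguessed?
    ... | yes _ =
      let (i , correct) = proj₂ (covering (pageColours c)) (spineColours c) (cong does unguessed?)
      in spine i , trans (play-spine i (spine? (spine i)) (page? (spine i)) c)
                     (trans correct (Vec.lookup∘tabulate _ i))
    ... | no guessed =
      let (w , ¬¬correct) = Fin.¬∀⟶∃¬ N _ (λ w → ¬? (pageGuess w (spineColours c) Fin.≟ lookup (pageColours c) w)) guessed
      in page w , trans (play-page w (spine? (page w)) (page? (page w)) c)
                    (trans (decidable-stable (_ Fin.≟ _) ¬¬correct) (Vec.lookup∘tabulate _ w))

    winnable : Winnable G q
    winnable = localised G zero (λ v c → play (spine? v) (page? v) c)
                 (λ v → play-local (spine? v) (page? v)) wins

  book-winnable : ∀ {n} (G : Graph n) k p m b .{{_ : NonZero k}} .{{_ : NonZero p}} .{{_ : NonZero b}} →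
    b ≤ k → suc p ^ suc (k + k) < 2 ^ m → suc p * m ≤ b ^ k →
    Book G (k + k) (suc p * m) → Winnable G (suc p)
  book-winnable G k p m b b≤k big N≤b^k book =
    let (F , F-excludes) = excluding-functions p (suc p ^ (k + k)) (suc p * m)
                             (few-functions-suffice p m (k + k) big)
    in BookStrategy.winnable G b≤k book N≤b^k F F-excludes

  -- Choice of parameters

  n<2^n : ∀ n → n < 2 ^ n
  n<2^n zero    = s≤s z≤n
  n<2^n (suc n) = begin-strict
    suc n            ≤⟨ n<2^n n ⟩
    2 ^ n            <⟨ ℕ.m<m+n (2 ^ n) (ℕ.≤-trans (ℕ.m^n>0 2 n) (ℕ.m≤m+n (2 ^ n) 0)) ⟩
    2 ^ n + (2 ^ n + 0)  ∎
    where open ≤-Reasoning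

  dyadic : ∀ n .{{_ : NonZero n}} → ∃ λ l → 2 ^ l ≤ n × n < 2 ^ suc l
  dyadic (suc zero)    = 0 , s≤s z≤n , s≤s (s≤s z≤n)
  dyadic (suc n@(suc _)) with dyadic n
  ... | l , lower , upper with suc n ℕ.<? 2 ^ suc l
  ...   | yes below = l , ℕ.m≤n⇒m≤1+n lower , below
  ...   | no above  = suc l , ℕ.≮⇒≥ above , ℕ.≤-<-trans upper (ℕ.^-monoʳ-< 2 (s≤s (s≤s z≤n)) (ℕ.n<1+n (suc l)))

  quotient-bounds : ∀ l a .{{_ : NonZero a}} → l / a * a ≤ l × l < suc (l / a) * a
  quotient-bounds l a = m/n*n≤m l a , (begin-strict
    l                      ≡⟨ m≡m%n+[m/n]*n l a ⟩
    l % a + l / a * a      <⟨ ℕ.+-monoˡ-< (l / a * a) (m%n<n l a) ⟩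
    a + l / a * a          ∎)
    where
    open ≤-Reasoning

  -- With x = j/3 rounded down, the factors linear in `j` are at most 6x and 13x, so the left side
  -- is at most 78ax^2 ≤ x^3 ≤ 2^(3x). The lower bound on `j` gives 78a ≤ x.
  2^-large : ∀ a j → 78 * a * 3 ≤ j → 0 < a → a * suc j * (2 * j + 3) ≤ 2 ^ j
  2^-large a j large 0<a = begin
    a * suc j * (2 * j + 3)           ≤⟨ ℕ.*-mono-≤ (ℕ.*-monoʳ-≤ a sucj≤) 2j+3≤ ⟩
    a * (6 * x) * (13 * x)            ≡⟨ rearrange a x ⟩
    78 * a * (x * x)                  ≤⟨ ℕ.*-monoˡ-≤ (x * x) 78a≤x ⟩
    x * (x * x)                       ≤⟨ ℕ.*-mono-≤ x≤ (ℕ.*-mono-≤ x≤ x≤) ⟩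
    2 ^ x * (2 ^ x * 2 ^ x)           ≡⟨ trans (cong (2 ^ x *_) (sym (ℕ.^-distribˡ-+-* 2 x x)))
                                               (sym (ℕ.^-distribˡ-+-* 2 x (x + x))) ⟩
    2 ^ (x + (x + x))                 ≤⟨ ℕ.^-monoʳ-≤ 2 (ℕ.≤-trans (ℕ.≤-reflexive (triple x)) (proj₁ bounds)) ⟩
    2 ^ j                             ∎
    where
    open ≤-Reasoning
    x = j / 3
    bounds = quotient-bounds j 3
    rearrange : ∀ a x → a * (6 * x) * (13 * x) ≡ 78 * a * (x * x)
    rearrange = solve-∀
    triple : ∀ x → x + (x + x) ≡ x * 3
    triple = solve-∀
    x≤ : x ≤ 2 ^ x
    x≤ = ℕ.<⇒≤ (n<2^n x)
    78a≤x : 78 * a ≤ x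
    78a≤x = ℕ.≤-trans (ℕ.≤-reflexive (sym (m*n/n≡m (78 * a) 3))) (/-monoˡ-≤ 3 large)
    1≤x : 1 ≤ x
    1≤x = ℕ.≤-trans (ℕ.*-mono-≤ {1} {78} (s≤s z≤n) 0<a) 78a≤x
    sucj≤ : suc j ≤ 6 * x
    sucj≤ = begin
      suc j             ≤⟨ proj₂ bounds ⟩
      3 + x * 3         ≤⟨ ℕ.+-monoˡ-≤ (x * 3) (ℕ.*-monoʳ-≤ 3 1≤x) ⟩
      3 * x + x * 3     ≡⟨ s x ⟩
      6 * x             ∎
      where
      s : ∀ x → 3 * x + x * 3 ≡ 6 * x
      s = solve-∀
    2j+3≤ : 2 * j + 3 ≤ 13 * x
    2j+3≤ = begin
      2 * j + 3           ≡⟨ s j ⟩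
      2 * suc j + 1       ≤⟨ ℕ.+-mono-≤ (ℕ.*-monoʳ-≤ 2 sucj≤) 1≤x ⟩
      2 * (6 * x) + x     ≡⟨ s′ x ⟩
      13 * x              ∎
      where
      s : ∀ j → 2 * j + 3 ≡ 2 * suc j + 1
      s = solve-∀
      s′ : ∀ x → 2 * (6 * x) + x ≡ 13 * x
      s′ = solve-∀

  -- On n vertices, 2^l ≤ n < 2^(l+1), the game is played with 2^s colours on a
  -- book with 2(j+1) spine vertices and 2^(s+j) pages, whose spine wins on sets of
  -- fewer than (2^a)^(j+1) colourings.  Passing to common neighbours of the spine
  -- costs a factor 8^(2(j+1)) and the pages a factor 2^j, so l = s + 7j + 6; with
  -- a = 14(k+1) and j = ⌊l/a⌋ this loss of about l/(2(k+1)) bits is affordable.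
  record Parameters (k n : ℕ) : Set where
    field
      a j l s      : ℕ
      n-lower      : 2 ^ l ≤ n
      n-upper      : n < 2 ^ suc l
      l-split      : l ≡ s + (7 * j + 6)
      l<a[j+1]     : l < a * suc j
      2^a≤j+1      : 2 ^ a ≤ suc j
      -- As 7j + 7 = l + 1 - s, this says (l + 1)k < s(k + 1), whence n^k ≤ (2^s)^(k+1).
      s-lower      : (7 * j + 7) * k < s
      2^j-lower    : a * suc j * (2 * j + 3) ≤ 2 ^ j
      k<a          : suc k ≤ a

    -- The product `suc p * m` of `book-winnable`, with `2 ^ s` colours and `m` = `2 ^ j`.
    pages : ℕ
    pages = 2 ^ s * 2 ^ j

  scale : ℕ → ℕ
  scale k = 14 * suc k

  -- It forces `j` to be at least the bracket, whose first summand serves `2^-large` and whose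
  -- second serves `2^a≤j+1`.
  threshold : ℕ → ℕ
  threshold k = 2 ^ ((78 * scale k * 3 + 2 ^ scale k) * scale k)

  parameters : ∀ k n → threshold k ≤ n → Parameters k n
  parameters k n large = record
    { a = a ; j = j ; l = l ; s = s
    ; n-lower = proj₁ (proj₂ log) ; n-upper = proj₂ (proj₂ log)
    ; l-split = trans (sym split) (ℕ.+-comm (7 * j + 6) s)
    ; l<a[j+1] = ℕ.<-≤-trans (proj₂ bounds) (ℕ.≤-reflexive (ℕ.*-comm (suc j) a))
    ; 2^a≤j+1 = ℕ.≤-trans (ℕ.m≤n+m _ (78 * a * 3)) (ℕ.m≤n⇒m≤1+n J≤j)
    ; s-lower = s-lower
    ; 2^j-lower = 2^-large a j (ℕ.≤-trans (ℕ.m≤m+n _ _) J≤j) (s≤s z≤n)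
    ; k<a = ℕ.m≤n*m (suc k) 14
    }
    where
    open ≤-Reasoning
    a = scale k
    J = 78 * a * 3 + 2 ^ a
    n-nonZero : NonZero n
    n-nonZero = >-nonZero (ℕ.≤-trans (ℕ.m^n>0 2 (J * a)) large)
    log = dyadic n {{n-nonZero}}
    l = proj₁ log
    j = l / a
    bounds = quotient-bounds l a

    Ja≤l : J * a ≤ l
    Ja≤l = ℕ.≮⇒≥ λ l<Ja → ℕ.<⇒≱ (proj₂ (proj₂ log)) (ℕ.≤-trans (ℕ.^-monoʳ-≤ 2 l<Ja) large)

    J≤j : J ≤ j
    J≤j = ℕ.≤-trans (ℕ.≤-reflexive (sym (m*n/n≡m J a))) (/-monoˡ-≤ a Ja≤l)

    1≤j : 1 ≤ j
    1≤j = ℕ.≤-trans (ℕ.≤-trans (ℕ.m^n>0 2 a) (ℕ.m≤n+m _ (78 * a * 3))) J≤j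

    -- The left side is (7j + 7)(k + 1). As j ≥ 1, it is at most 14j(k + 1) = ja ≤ l, which is where
    -- the 14 in `scale` comes from.
    need : (7 * j + 6) + suc ((7 * j + 7) * k) ≤ l
    need = begin
      (7 * j + 6) + suc ((7 * j + 7) * k)          ≡⟨ lhs j k ⟩
      7 * j + 7 * 1 + (7 * j + 7 * 1) * k          ≤⟨ ℕ.+-mono-≤ (ℕ.+-monoʳ-≤ (7 * j) (ℕ.*-monoʳ-≤ 7 1≤j))
                                                       (ℕ.*-monoˡ-≤ k (ℕ.+-monoʳ-≤ (7 * j) (ℕ.*-monoʳ-≤ 7 1≤j))) ⟩
      7 * j + 7 * j + (7 * j + 7 * j) * k          ≡⟨ rhs j k ⟩
      j * (14 * suc k)                             ≤⟨ proj₁ bounds ⟩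
      l                                            ∎
      where
      lhs : ∀ j k → (7 * j + 6) + suc ((7 * j + 7) * k) ≡ 7 * j + 7 * 1 + (7 * j + 7 * 1) * k
      lhs = solve-∀
      rhs : ∀ j k → 7 * j + 7 * j + (7 * j + 7 * j) * k ≡ j * (14 * suc k)
      rhs = solve-∀

    splitting : ∃ λ s → (7 * j + 6) + s ≡ l
    splitting = l ∸ (7 * j + 6) , ℕ.m+[n∸m]≡n (ℕ.≤-trans (ℕ.m≤m+n (7 * j + 6) _) need)
    s = proj₁ splitting
    split = proj₂ splitting

    s-lower : (7 * j + 7) * k < s
    s-lower = ℕ.+-cancelˡ-≤ (7 * j + 6) _ _ (ℕ.≤-trans need (ℕ.≤-reflexive (sym split)))

  1+d : ∀ j → suc (suc j + suc j) ≡ 2 * j + 3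
  1+d = solve-∀

  module _ {k n} (π : Parameters k n) where
    open Parameters π
    open ≤-Reasoning

    8^d*pages≤n : 8 ^ (suc j + suc j) * pages ≤ n
    8^d*pages≤n = begin
      8 ^ (suc j + suc j) * (2 ^ s * 2 ^ j)
        ≡⟨ cong₂ _*_ (ℕ.^-*-assoc 2 3 (suc j + suc j)) (sym (ℕ.^-distribˡ-+-* 2 s j)) ⟩
      2 ^ (3 * (suc j + suc j)) * 2 ^ (s + j)
        ≡⟨ ℕ.^-distribˡ-+-* 2 (3 * (suc j + suc j)) (s + j) ⟨
      2 ^ (3 * (suc j + suc j) + (s + j))
        ≡⟨ cong (2 ^_) (trans (exponent j s) (sym l-split)) ⟩
      2 ^ l
        ≤⟨ n-lower ⟩
      n ∎
      where
      exponent : ∀ j s → 3 * (suc j + suc j) + (s + j) ≡ s + (7 * j + 6)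
      exponent = solve-∀

    pages-nonZero : NonZero pages
    pages-nonZero = >-nonZero (ℕ.*-mono-≤ (ℕ.m^n>0 2 s) (ℕ.m^n>0 2 j))

    pages≤ : pages ≤ (2 ^ a) ^ suc j
    pages≤ = begin
      2 ^ s * 2 ^ j      ≡⟨ ℕ.^-distribˡ-+-* 2 s j ⟨
      2 ^ (s + j)        ≤⟨ ℕ.^-monoʳ-≤ 2 (begin
        s + j              ≤⟨ ℕ.+-monoʳ-≤ s (ℕ.≤-trans (ℕ.m≤n*m j 7) (ℕ.m≤m+n _ 6)) ⟩
        s + (7 * j + 6)    ≡⟨ l-split ⟨
        l                  ≤⟨ ℕ.<⇒≤ l<a[j+1] ⟩
        a * suc j          ∎) ⟩
      2 ^ (a * suc j)    ≡⟨ ℕ.^-*-assoc 2 a (suc j) ⟨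
      (2 ^ a) ^ suc j    ∎

    spine-bits : (2 ^ s) ^ suc (suc j + suc j) < 2 ^ 2 ^ j
    spine-bits = begin-strict
      (2 ^ s) ^ suc (suc j + suc j)     ≡⟨ ℕ.^-*-assoc 2 s (suc (suc j + suc j)) ⟩
      2 ^ (s * suc (suc j + suc j))     <⟨ ℕ.^-monoʳ-< 2 (s≤s (s≤s z≤n)) (begin-strict
        s * suc (suc j + suc j)           <⟨ ℕ.*-monoˡ-< (suc (suc j + suc j)) s<a[j+1] ⟩
        a * suc j * suc (suc j + suc j)   ≡⟨ cong (a * suc j *_) (1+d j) ⟩
        a * suc j * (2 * j + 3)           ≤⟨ 2^j-lower ⟩
        2 ^ j                             ∎) ⟩
      2 ^ 2 ^ j                         ∎
      where
      s<a[j+1] : s < a * suc j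
      s<a[j+1] = ℕ.≤-<-trans (ℕ.≤-trans (ℕ.m≤m+n s _) (ℕ.≤-reflexive (sym l-split))) l<a[j+1]

    -- It will bound the failure probability d 2^(-N) of the greedy choice, with d = 2(j + 1) and N
    -- = `pages`, by 1/(k + 1).
    failure-bits : suc k * (suc j + suc j) ≤ 2 ^ pages
    failure-bits = begin
      suc k * (suc j + suc j)      ≤⟨ ℕ.*-mono-≤ (ℕ.≤-trans k<a (ℕ.m≤m*n a (suc j))) d≤ ⟩
      a * suc j * (2 * j + 3)      ≤⟨ 2^j-lower ⟩
      2 ^ j                        ≤⟨ ℕ.m≤n*m (2 ^ j) (2 ^ s) {{ℕ.m^n≢0 2 s}} ⟩
      pages                        ≤⟨ ℕ.<⇒≤ (n<2^n pages) ⟩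
      2 ^ pages                    ∎
      where
      d≤ : suc j + suc j ≤ 2 * j + 3
      d≤ = ℕ.≤-trans (ℕ.n≤1+n _) (ℕ.≤-reflexive (1+d j))

    n^k≤colours : n ^ k ≤ (2 ^ s) ^ suc k
    n^k≤colours = begin
      n ^ k                 ≤⟨ ℕ.^-monoˡ-≤ k (ℕ.<⇒≤ n-upper) ⟩
      (2 ^ suc l) ^ k       ≡⟨ ℕ.^-*-assoc 2 (suc l) k ⟩
      2 ^ (suc l * k)       ≤⟨ ℕ.^-monoʳ-≤ 2 exponents ⟩
      2 ^ (s * suc k)       ≡⟨ ℕ.^-*-assoc 2 s (suc k) ⟨
      (2 ^ s) ^ suc k       ∎
      where
      expand : ∀ s j k → suc (s + (7 * j + 6)) * k ≡ (7 * j + 7) * k + s * k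
      expand = solve-∀
      exponents : suc l * k ≤ s * suc k
      exponents = begin
        suc l * k                   ≡⟨ cong (λ l → suc l * k) l-split ⟩
        suc (s + (7 * j + 6)) * k   ≡⟨ expand s j k ⟩
        (7 * j + 7) * k + s * k     ≤⟨ ℕ.+-monoˡ-≤ (s * k) (ℕ.<⇒≤ s-lower) ⟩
        s + s * k                   ≡⟨ ℕ.*-suc s k ⟨
        s * suc k                   ∎

    colours-winnable : (G : Graph n) → Book G (suc j + suc j) pages → Winnable G (2 ^ s)
    colours-winnable G book = win (2 ^ s) refl
      where
      2≤2^s : 2 ≤ 2 ^ s
      2≤2^s = ℕ.^-monoʳ-≤ 2 (ℕ.≤-trans (s≤s z≤n) s-lower)

      -- `book-winnable` asks for `suc p` colours with `p` nonzero, so `2 ^ s` is generalised to a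
      -- variable that can be split.
      win : ∀ q → q ≡ 2 ^ s → Winnable G q
      win zero          eq = contradiction (ℕ.≤-trans 2≤2^s (ℕ.≤-reflexive (sym eq))) λ ()
      win (suc zero)    eq = contradiction (ℕ.≤-trans 2≤2^s (ℕ.≤-reflexive (sym eq))) λ { (s≤s ()) }
      win (suc p@(suc _)) eq = book-winnable G (suc j) p (2 ^ j) (2 ^ a) {{_}} {{_}} {{ℕ.m^n≢0 2 a}} 2^a≤j+1
        (subst (λ q → q ^ suc (suc j + suc j) < 2 ^ 2 ^ j) (sym eq) spine-bits)
        (subst (λ q → q * 2 ^ j ≤ (2 ^ a) ^ suc j) (sym eq) pages≤)
        (subst (λ q → Book G (suc j + suc j) (q * 2 ^ j)) (sym eq) book)

    HG-large : (G : Graph n) → Book G (suc j + suc j) pages → n ^ k ≤ HG G ^ suc k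
    HG-large G book = ℕ.≤-trans n^k≤colours (ℕ.^-monoˡ-≤ (suc k)
      (largestUpTo-upper (winnable? G) n (2 ^ s) (winnable⇒≤ G (2 ^ s) win) win))
      where
      win = colours-winnable G book

module RandomGraphs where

  open import Data.Rational.Base
  open import Data.Rational.Properties using (module ≤-Reasoning)
  open +-*-Solver using (solve; _:+_; _:*_; _:-_; :-_; _:=_; con)
  open HatGuessing

  -- Books in random graphs

  pow : ℚ → ℕ → ℚ
  pow x zero    = 1ℚ
  pow x (suc n) = x * pow x n

  2ℚ ¾ : ℚ
  2ℚ = 1ℚ + 1ℚ
  ¾ = ½ * (1ℚ + ½)

  pow-positive : ∀ x .{{_ : Positive x}} n → Positive (pow x n)
  pow-positive x zero    = _
  pow-positive x (suc n) = ℚ.pos*pos⇒pos x (pow x n) {{pow-positive x n}}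

  pow-nonNegative : ∀ x .{{_ : Positive x}} n → NonNegative (pow x n)
  pow-nonNegative x n = ℚ.pos⇒nonNeg (pow x n) {{pow-positive x n}}

  pow≤1 : ∀ x .{{_ : Positive x}} → x ≤ 1ℚ → ∀ n → pow x n ≤ 1ℚ
  pow≤1 x x≤1 zero    = ℚ.≤-refl
  pow≤1 x x≤1 (suc n) = begin
    x * pow x n    ≤⟨ ℚ.*-monoʳ-≤-nonNeg (pow x n) {{pow-nonNegative x n}} x≤1 ⟩
    1ℚ * pow x n   ≡⟨ ℚ.*-identityˡ (pow x n) ⟩
    pow x n        ≤⟨ pow≤1 x x≤1 n ⟩
    1ℚ             ∎
    where open ≤-Reasoning

  pow-antitone : ∀ x .{{_ : Positive x}} → x ≤ 1ℚ → ∀ {m n} → m ℕ.≤ n → pow x n ≤ pow x m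
  pow-antitone x x≤1 {zero}  {n}     z≤n       = pow≤1 x x≤1 n
  pow-antitone x x≤1 {suc m} {suc n} (s≤s m≤n) =
    ℚ.*-monoˡ-≤-nonNeg x {{ℚ.pos⇒nonNeg x}} (pow-antitone x x≤1 m≤n)

  pow-inverse : ∀ n → pow 2ℚ n * pow ½ n ≡ 1ℚ
  pow-inverse zero    = refl
  pow-inverse (suc n) =
    trans (solve 2 (λ x y → (con 2ℚ :* x) :* (con ½ :* y) := x :* y) refl (pow 2ℚ n) (pow ½ n))
          (pow-inverse n)

  1≤pow2*pow½ : ∀ {m n} → m ℕ.≤ n → 1ℚ ≤ pow 2ℚ n * pow ½ m
  1≤pow2*pow½ {m} {n} m≤n = begin
    1ℚ                  ≡⟨ pow-inverse n ⟨
    pow 2ℚ n * pow ½ n  ≤⟨ ℚ.*-monoˡ-≤-nonNeg (pow 2ℚ n) {{pow-nonNegative 2ℚ n}}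
                            (pow-antitone ½ (ℚ.≤ᵇ⇒≤ {½} {1ℚ} _) m≤n) ⟩
    pow 2ℚ n * pow ½ m  ∎
    where
    open ≤-Reasoning

  -- Six factors `¾` pay for one factor 2 and still leave at most 1/2: 2(3/4)^6 = 729/2048.
  pow-¾-tail : ∀ t → pow 2ℚ t * pow ¾ (t ℕ.* 6) ≤ pow ½ t
  pow-¾-tail zero    = ℚ.≤-refl
  pow-¾-tail (suc t) = begin
    2ℚ * x * (¾ * (¾ * (¾ * (¾ * (¾ * (¾ * y))))))
      ≡⟨ solve 2 (λ x y → con 2ℚ :* x :* (con ¾ :* (con ¾ :* (con ¾ :* (con ¾ :* (con ¾ :* (con ¾ :* y))))))
                          := con K :* (x :* y)) refl x y ⟩
    K * (x * y)       ≤⟨ ℚ.*-monoˡ-≤-nonNeg K (pow-¾-tail t) ⟩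
    K * pow ½ t       ≤⟨ ℚ.*-monoʳ-≤-nonNeg (pow ½ t) {{pow-nonNegative ½ t}} (ℚ.≤ᵇ⇒≤ {K} {½} _) ⟩
    ½ * pow ½ t       ∎
    where
    open ≤-Reasoning
    x = pow 2ℚ t
    y = pow ¾ (t ℕ.* 6)
    K = 2ℚ * pow ¾ 6

  -- Expectations over fair bits

  𝔼-bits-mono : ∀ m {X Y : Vec Bool m → ℚ} → (∀ r → X r ≤ Y r) → 𝔼-bits ½ m X ≤ 𝔼-bits ½ m Y
  𝔼-bits-mono zero    X≤Y = X≤Y []
  𝔼-bits-mono (suc m) X≤Y = ℚ.+-mono-≤
    (ℚ.*-monoˡ-≤-nonNeg ½ (𝔼-bits-mono m (λ r → X≤Y (true ∷ r))))
    (ℚ.*-monoˡ-≤-nonNeg ½ (𝔼-bits-mono m (λ r → X≤Y (false ∷ r))))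

  ½+½ : ∀ c → ½ * c + ½ * c ≡ c
  ½+½ = solve 1 (λ c → con ½ :* c :+ con ½ :* c := c) refl

  𝔼-bits-const : ∀ m c → 𝔼-bits ½ m (λ _ → c) ≡ c
  𝔼-bits-const zero    c = refl
  𝔼-bits-const (suc m) c = trans (cong₂ (λ x y → ½ * x + ½ * y) (𝔼-bits-const m c) (𝔼-bits-const m c)) (½+½ c)

  𝔼-edges-mono : ∀ n {X Y : EdgeBits n → ℚ} → (∀ e → X e ≤ Y e) → 𝔼-edges ½ n X ≤ 𝔼-edges ½ n Y
  𝔼-edges-mono zero    X≤Y = X≤Y []
  𝔼-edges-mono (suc n) X≤Y =
    𝔼-bits-mono n (λ r → 𝔼-edges-mono n (λ e → X≤Y (r ∷ e)))

  𝔼-edges-const : ∀ n c → 𝔼-edges ½ n (λ _ → c) ≡ c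
  𝔼-edges-const zero    c = refl
  𝔼-edges-const (suc n) c = begin
    𝔼-bits ½ n (λ _ → 𝔼-edges ½ n (λ _ → c))   ≡⟨ 𝔼-bits-const n _ ⟩
    𝔼-edges ½ n (λ _ → c)                      ≡⟨ 𝔼-edges-const n c ⟩
    c                                          ∎
    where open ≡-Reasoning

  𝔼-bits-≥ : ∀ m {c} {X : Vec Bool m → ℚ} → (∀ r → c ≤ X r) → c ≤ 𝔼-bits ½ m X
  𝔼-bits-≥ m {c} c≤X = ℚ.≤-trans (ℚ.≤-reflexive (sym (𝔼-bits-const m c))) (𝔼-bits-mono m c≤X)

  𝔼-edges-≥ : ∀ n {c} {X : EdgeBits n → ℚ} → (∀ e → c ≤ X e) → c ≤ 𝔼-edges ½ n X
  𝔼-edges-≥ n {c} c≤X = ℚ.≤-trans (ℚ.≤-reflexive (sym (𝔼-edges-const n c))) (𝔼-edges-mono n c≤X)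

  𝔼-edges-≤ : ∀ n {c} {X : EdgeBits n → ℚ} → (∀ e → X e ≤ c) → 𝔼-edges ½ n X ≤ c
  𝔼-edges-≤ n {c} X≤c = ℚ.≤-trans (𝔼-edges-mono n X≤c) (ℚ.≤-reflexive (𝔼-edges-const n c))

  _∩_ : ∀ {n} → Subset n → Subset n → Subset n
  _∩_ = zipWith _∧_

  -- The exponential moment 𝔼 2^(- |A ∩ r|) = (3/4)^|A| of a random row r.
  𝔼-bits-∩ : ∀ {m} (A : Subset m) c w (X : Vec Bool m → ℚ) →
             (∀ r → c - w * pow ½ (size (A ∩ r)) ≤ X r) → c - w * pow ¾ (size A) ≤ 𝔼-bits ½ m X
  𝔼-bits-∩ []          c w X h = h []
  𝔼-bits-∩ {suc m} (false ∷ A) c w X h = begin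
    Z                    ≡⟨ ½+½ Z ⟨
    ½ * Z + ½ * Z        ≤⟨ ℚ.+-mono-≤ (ℚ.*-monoˡ-≤-nonNeg ½ (𝔼-bits-∩ A c w _ (λ r → h (true ∷ r))))
                                       (ℚ.*-monoˡ-≤-nonNeg ½ (𝔼-bits-∩ A c w _ (λ r → h (false ∷ r)))) ⟩
    𝔼-bits ½ (suc m) X   ∎
    where
    open ≤-Reasoning
    Z = c - w * pow ¾ (size A)
  𝔼-bits-∩ {suc m} (true ∷ A) c w X h = begin
    -- A bit `true` adds 1 to the size of the intersection, and the resulting factor 1/2 is absorbed
    -- into the weight `w`; a bit `false` leaves `w` alone. The average of 1/2 and 1 is 3/4.
    c - w * (¾ * P)
      ≡⟨ solve 3 (λ c w P → c :- w :* (con ¾ :* P) := con ½ :* (c :- w :* con ½ :* P) :+ con ½ :* (c :- w :* P)) refl c w P ⟩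
    ½ * (c - w * ½ * P) + ½ * (c - w * P)
      ≤⟨ ℚ.+-mono-≤ (ℚ.*-monoˡ-≤-nonNeg ½ (𝔼-bits-∩ A c (w * ½) _ hit))
                    (ℚ.*-monoˡ-≤-nonNeg ½ (𝔼-bits-∩ A c w _ (λ r → h (false ∷ r)))) ⟩
    𝔼-bits ½ (suc m) X   ∎
    where
    open ≤-Reasoning
    P = pow ¾ (size A)
    hit : ∀ r → c - w * ½ * pow ½ (size (A ∩ r)) ≤ X (true ∷ r)
    hit r = ℚ.≤-trans (ℚ.≤-reflexive (cong (λ z → c - z) (ℚ.*-assoc w ½ _))) (h (true ∷ r))

  -- Choose d pairwise adjacent vertices of A greedily, each time passing to the
  -- neighbours of the chosen vertex; are at least N candidates left?
  greedy : ∀ {n} → ℕ → ℕ → Subset n → EdgeBits n → Bool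
  greedy zero    N A           e       = N ℕ.≤ᵇ size A
  greedy (suc d) N []          []      = false
  greedy (suc d) N (false ∷ A) (r ∷ e) = greedy (suc d) N A e
  greedy (suc d) N (true ∷ A)  (r ∷ e) = greedy d N (A ∩ r) e

  𝟙ℚ : Bool → ℚ
  𝟙ℚ b = if b then 1ℚ else 0ℚ

  0≤𝟙ℚ : ∀ b → 0ℚ ≤ 𝟙ℚ b
  0≤𝟙ℚ true  = ℚ.≤ᵇ⇒≤ {0ℚ} {1ℚ} _
  0≤𝟙ℚ false = ℚ.≤-refl

  𝟙ℚ≤1 : ∀ b → 𝟙ℚ b ≤ 1ℚ
  𝟙ℚ≤1 true  = ℚ.≤-refl
  𝟙ℚ≤1 false = ℚ.≤ᵇ⇒≤ {0ℚ} {1ℚ} _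

  ι : ℕ → ℚ
  ι zero    = 0ℚ
  ι (suc n) = 1ℚ + ι n

  ι-nonNegative : ∀ n → NonNegative (ι n)
  ι-nonNegative zero    = _
  ι-nonNegative (suc n) = ℚ.nonNeg+nonNeg⇒nonNeg 1ℚ (ι n) {{ι-nonNegative n}}

  x-y≤x : ∀ x y → .{{NonNegative y}} → x - y ≤ x
  x-y≤x x y = ℚ.≤-trans (ℚ.+-monoʳ-≤ x (ℚ.neg-antimono-≤ (ℚ.nonNegative⁻¹ y)))
                        (ℚ.≤-reflexive (ℚ.+-identityʳ x))

  -- The row of a vertex is revealed only when the vertex is reached, so it is independent of the
  -- current `A`. By the exponential moment, choosing a vertex leaves fewer than t = 8^d N
  -- candidates with probability at most 2^t (3/4)^|A| ≤ 2^(-N), and these failures add up over the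
  -- chosen vertices.
  greedy-likely : ∀ d N .{{_ : ℕ.NonZero N}} {n} (A : Subset n) → 8 ℕ.^ d ℕ.* N ℕ.≤ size A →
                  1ℚ - ι d * pow ½ N ≤ 𝔼-edges ½ n (λ e → 𝟙ℚ (greedy d N A e))
  greedy-likely zero N {n} A large = 𝔼-edges-≥ n (λ e → success)
    where
    success : 1ℚ - 0ℚ * pow ½ N ≤ 𝟙ℚ (N ℕ.≤ᵇ size A)
    success with N ℕ.≤ᵇ size A | ℕ.≤⇒≤ᵇ (ℕ.≤-trans (ℕ.≤-reflexive (sym (ℕ.*-identityˡ N))) large)
    ... | true | _ = ℚ.≤-reflexive (cong (λ z → 1ℚ - z) (ℚ.*-zeroˡ (pow ½ N)))
  greedy-likely (suc d) N [] large =
    contradiction (ℕ.≤-trans (ℕ.*-mono-≤ (ℕ.m^n>0 8 (suc d)) (ℕ.>-nonZero⁻¹ N)) large) λ ()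
  greedy-likely (suc d) N {suc n} (false ∷ A) large =
    𝔼-bits-≥ n (λ r → greedy-likely (suc d) N A large)
  greedy-likely (suc d) N {suc n} (true ∷ A) large = begin
    1ℚ - (1ℚ + ι d) * pow ½ N
      ≡⟨ solve 2 (λ x y → con 1ℚ :- (con 1ℚ :+ x) :* y := (con 1ℚ :- x :* y) :- y) refl (ι d) (pow ½ N) ⟩
    c - pow ½ N
      ≤⟨ ℚ.+-monoʳ-≤ c (ℚ.neg-antimono-≤ tail) ⟩
    c - pow 2ℚ t * pow ¾ (size A)
      ≤⟨ 𝔼-bits-∩ A c (pow 2ℚ t) _ row ⟩
    𝔼-edges ½ (suc n) (λ e → 𝟙ℚ (greedy (suc d) N (true ∷ A) e)) ∎
    where
    open ≤-Reasoning
    t = 8 ℕ.^ d ℕ.* N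
    c = 1ℚ - ι d * pow ½ N

    1≤t : 1 ℕ.≤ t
    1≤t = ℕ.*-mono-≤ (ℕ.m^n>0 8 d) (ℕ.>-nonZero⁻¹ N)

    N≤t : N ℕ.≤ t
    N≤t = ℕ.m≤n*m N (8 ℕ.^ d) {{ℕ.m^n≢0 8 d}}

    -- The chosen vertex is no longer a candidate, which leaves at least 8t - 1 ≥ 6t of them, as t ≥
    -- 1.
    6t≤A : t ℕ.* 6 ℕ.≤ size A
    6t≤A = ℕ.≤-pred (ℕ.≤-trans bound large)
      where
      module R = ℕ.≤-Reasoning
      bound : suc (t ℕ.* 6) ℕ.≤ 8 ℕ.* 8 ℕ.^ d ℕ.* N
      bound = R.begin
        1 ℕ.+ t ℕ.* 6            R.≤⟨ ℕ.+-mono-≤ (ℕ.≤-trans 1≤t (ℕ.m≤m*n t 2)) ℕ.≤-refl ⟩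
        t ℕ.* 2 ℕ.+ t ℕ.* 6      R.≡⟨ ℕ.*-distribˡ-+ t 2 6 ⟨
        t ℕ.* 8                  R.≡⟨ ℕ.*-comm t 8 ⟩
        8 ℕ.* t                  R.≡⟨ ℕ.*-assoc 8 (8 ℕ.^ d) N ⟨
        8 ℕ.* 8 ℕ.^ d ℕ.* N      R.∎

    tail : pow 2ℚ t * pow ¾ (size A) ≤ pow ½ N
    tail = begin
      pow 2ℚ t * pow ¾ (size A)      ≤⟨ ℚ.*-monoˡ-≤-nonNeg (pow 2ℚ t) {{pow-nonNegative 2ℚ t}}
                                          (pow-antitone ¾ (ℚ.≤ᵇ⇒≤ {¾} {1ℚ} _) 6t≤A) ⟩
      pow 2ℚ t * pow ¾ (t ℕ.* 6)     ≤⟨ pow-¾-tail t ⟩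
      pow ½ t                        ≤⟨ pow-antitone ½ (ℚ.≤ᵇ⇒≤ {½} {1ℚ} _) N≤t ⟩
      pow ½ N                        ∎

    loss : ℕ → ℚ
    loss s = pow 2ℚ t * pow ½ s

    c≤1 : c ≤ 1ℚ
    c≤1 = x-y≤x 1ℚ (ι d * pow ½ N)
            {{ℚ.nonNeg*nonNeg⇒nonNeg (ι d) {{ι-nonNegative d}} (pow ½ N) {{pow-nonNegative ½ N}}}}

    -- With at least `t` candidates left, the induction hypothesis holds even without subtracting
    -- the loss; with fewer, the loss is at least 1 and the left side at most 0.
    row : ∀ r → c - loss (size (A ∩ r)) ≤ 𝔼-edges ½ n (λ e → 𝟙ℚ (greedy d N (A ∩ r) e))
    row r with t ℕ.≤? size (A ∩ r)
    ... | yes t≤ = ℚ.≤-trans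
      (x-y≤x c (loss s) {{ℚ.nonNeg*nonNeg⇒nonNeg (pow 2ℚ t) {{pow-nonNegative 2ℚ t}} (pow ½ s) {{pow-nonNegative ½ s}}}})
      (greedy-likely d N (A ∩ r) t≤)
      where s = size (A ∩ r)
    ... | no t≰ = begin
      c - loss (size (A ∩ r))      ≤⟨ ℚ.+-mono-≤ c≤1 (ℚ.neg-antimono-≤ (1≤pow2*pow½ (ℕ.<⇒≤ (ℕ.≰⇒> t≰)))) ⟩
      1ℚ - 1ℚ                      ≤⟨ 𝔼-edges-≥ n (λ e → 0≤𝟙ℚ (greedy d N (A ∩ r) e)) ⟩
      𝔼-edges ½ n (λ e → 𝟙ℚ (greedy d N (A ∩ r) e)) ∎

  -- Books from successful greedy choices

  -- Membership in `A` is what carries the induction: once vertex `zero` is chosen, lying in `A ∩ r`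
  -- means being adjacent to it.
  record BookIn {n} (A : Subset n) (e : EdgeBits n) (d N : ℕ) : Set where
    field
      book     : Book (toGraph e) d N
      spine-in : ∀ i → lookup A (Book.spine book i) ≡ true
      page-in  : ∀ w → lookup A (Book.page book w) ≡ true

  enumerate : ∀ {n} N (A : Subset n) → N ℕ.≤ size A →
    ∃ λ (page : Fin N → Fin n) → (∀ w → lookup A (page w) ≡ true) × (∀ w w′ → page w ≡ page w′ → w ≡ w′)
  enumerate zero    A           N≤ = (λ ()) , (λ ()) , λ ()
  enumerate (suc N) (false ∷ A) N≤ =
    let (page , page-in , inj) = enumerate (suc N) A N≤
    in suc ∘ page , page-in , λ w w′ eq → inj w w′ (Fin.suc-injective eq)
  enumerate (suc N) (true ∷ A)  N≤ =
    let (page , page-in , inj) = enumerate N A (ℕ.≤-pred N≤)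
    in (λ { zero → zero ; (suc w) → suc (page w) })
     , (λ { zero → refl ; (suc w) → page-in w })
     , (λ { zero zero _ → refl ; (suc w) (suc w′) eq → cong suc (inj w w′ (Fin.suc-injective eq)) })

  lookup-∩ : ∀ {n} (A r : Subset n) i → lookup (A ∩ r) i ≡ true → lookup A i ≡ true × lookup r i ≡ true
  lookup-∩ (true  ∷ A) (true ∷ r) zero    _  = refl , refl
  lookup-∩ (true  ∷ A) (false ∷ r) zero    ()
  lookup-∩ (false ∷ A) (_    ∷ r) zero    ()
  lookup-∩ (_     ∷ A) (_    ∷ r) (suc i) eq = lookup-∩ A r i eq

  greedy-sound : ∀ {n} d N (A : Subset n) e → greedy d N A e ≡ true → BookIn A e d N
  greedy-sound zero N A e found =
    let (page , page-in , inj) = enumerate N A (ℕ.≤ᵇ⇒≤ N (size A) (subst T (sym found) _))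
    in record
      { book = record { spine = λ () ; page = page ; spine-adj = λ () ; page-adj = λ _ ()
                      ; page-injective = inj }
      ; spine-in = λ () ; page-in = page-in }
  greedy-sound (suc d) N [] [] ()
  greedy-sound {suc n} (suc d) N (false ∷ A) (r ∷ e) found = record
    { book = record
        { spine = suc ∘ spine ; page = suc ∘ page
        ; spine-adj = spine-adj ; page-adj = page-adj
        ; page-injective = λ w w′ eq → page-injective w w′ (Fin.suc-injective eq) }
    ; spine-in = spine-in ; page-in = page-in }
    where
    open BookIn (greedy-sound (suc d) N A e found)
    open Book book
  greedy-sound {suc n} (suc d) N (true ∷ A) (r ∷ e) found = record
    { book = record
        { spine = spine′ ; page = suc ∘ page
        ; spine-adj = spine-adj′ ; page-adj = page-adj′
        ; page-injective = λ w w′ eq → page-injective w w′ (Fin.suc-injective eq) }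
    ; spine-in = λ { zero → refl ; (suc i) → proj₁ (lookup-∩ A r (spine i) (spine-in i)) }
    ; page-in = λ w → proj₁ (lookup-∩ A r (page w) (page-in w)) }
    where
    open BookIn (greedy-sound d N (A ∩ r) e found)
    open Book book

    spine′ : Fin (suc d) → Fin (suc n)
    spine′ zero    = zero
    spine′ (suc i) = suc (spine i)

    spine-adj′ : ∀ i j → i ≢ j → edgeBit (r ∷ e) (spine′ i) (spine′ j) ≡ true
    spine-adj′ zero    zero    0≢0 = contradiction refl 0≢0
    spine-adj′ zero    (suc j) _   = proj₂ (lookup-∩ A r (spine j) (spine-in j))
    spine-adj′ (suc i) zero    _   = proj₂ (lookup-∩ A r (spine i) (spine-in i))
    spine-adj′ (suc i) (suc j) i≢j = spine-adj i j (λ { refl → i≢j refl })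

    page-adj′ : ∀ w i → edgeBit (r ∷ e) (suc (page w)) (spine′ i) ≡ true
    page-adj′ w zero    = proj₂ (lookup-∩ A r (page w) (page-in w))
    page-adj′ w (suc i) = page-adj w i

  full : ∀ n → Subset n
  full n = Vec.replicate n true

  size-full : ∀ n → size (full n) ≡ n
  size-full zero    = refl
  size-full (suc n) = cong suc (size-full n)

  likely-if-book : ∀ d N .{{_ : ℕ.NonZero N}} n → 8 ℕ.^ d ℕ.* N ℕ.≤ n →
    (P : Graph n → Set) (P? : ∀ G → Dec (P G)) → (∀ G → Book G d N → P G) →
    1ℚ - ι d * pow ½ N ≤ ℙ[G⟨ n , ½ ⟩∈ P? ]
  likely-if-book d N n large P P? sufficient = begin
    1ℚ - ι d * pow ½ N
      ≤⟨ greedy-likely d N (full n) (ℕ.≤-trans large (ℕ.≤-reflexive (sym (size-full n)))) ⟩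
    𝔼-edges ½ n (λ e → 𝟙ℚ (greedy d N (full n) e))
      ≤⟨ 𝔼-edges-mono n implied ⟩
    𝔼-edges ½ n (λ e → 𝟙ℚ (does (P? (toGraph e)))) ∎
    where
    open ≤-Reasoning
    implied : ∀ e → 𝟙ℚ (greedy d N (full n) e) ≤ 𝟙ℚ (does (P? (toGraph e)))
    implied e with greedy d N (full n) e in found
    ... | false = 0≤𝟙ℚ _
    ... | true  = ℚ.≤-reflexive (cong 𝟙ℚ (sym (dec-true (P? (toGraph e))
                    (sufficient (toGraph e) (BookIn.book (greedy-sound d N (full n) e found))))))

  -- Asymptotics

  ι≡ : ∀ n → ι n ≡ mkℚ (ℤ.+ n) 0 (Coprime.sym (Coprime.1-coprimeTo n))
  ι≡ zero    = refl
  ι≡ (suc n) = trans (cong (1ℚ +_) (ι≡ n))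
    (ℚ.toℚᵘ-injective (ℚᵘ.≃-trans
      (ℚ.toℚᵘ-homo-+ 1ℚ (mkℚ (ℤ.+ n) 0 (Coprime.sym (Coprime.1-coprimeTo n))))
      (ℚᵘ.*≡* (cross (ℤ.+ n)))))
    where
    cross : ∀ x → (ℤ.+ 1 ℤ.* ℤ.+ 1 ℤ.+ x ℤ.* ℤ.+ 1) ℤ.* ℤ.+ 1 ≡ (ℤ.+ 1 ℤ.+ x) ℤ.* (ℤ.+ 1 ℤ.* ℤ.+ 1)
    cross = ℤ.solve-∀

  ι-+ : ∀ m n → ι (m ℕ.+ n) ≡ ι m + ι n
  ι-+ zero    n = sym (ℚ.+-identityˡ (ι n))
  ι-+ (suc m) n = trans (cong (1ℚ +_) (ι-+ m n)) (sym (ℚ.+-assoc 1ℚ (ι m) (ι n)))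

  ι-* : ∀ m n → ι (m ℕ.* n) ≡ ι m * ι n
  ι-* zero    n = sym (ℚ.*-zeroˡ (ι n))
  ι-* (suc m) n = begin
    ι (n ℕ.+ m ℕ.* n)     ≡⟨ ι-+ n (m ℕ.* n) ⟩
    ι n + ι (m ℕ.* n)     ≡⟨ cong (ι n +_) (ι-* m n) ⟩
    ι n + ι m * ι n       ≡⟨ solve 2 (λ x y → y :+ x :* y := (con 1ℚ :+ x) :* y) refl (ι m) (ι n) ⟩
    (1ℚ + ι m) * ι n      ∎
    where open ≡-Reasoning

  ι-mono : ∀ {m n} → m ℕ.≤ n → ι m ≤ ι n
  ι-mono {n = n} z≤n = ℚ.nonNegative⁻¹ (ι n) {{ι-nonNegative n}}
  ι-mono (s≤s m≤n)   = ℚ.+-monoʳ-≤ 1ℚ (ι-mono m≤n)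

  ι-2^ : ∀ n → ι (2 ℕ.^ n) ≡ pow 2ℚ n
  ι-2^ zero    = refl
  ι-2^ (suc n) = trans (ι-* 2 (2 ℕ.^ n)) (cong (2ℚ *_) (ι-2^ n))

  -- 1/(k+1)
  recip : ℕ → ℚ
  recip k = mkℚ (ℤ.+ 1) k (Coprime.1-coprimeTo (suc k))

  recip*ι : ∀ k → recip k * ι (suc k) ≡ 1ℚ
  recip*ι k = trans (cong (recip k *_) (ι≡ (suc k)))
    (ℚ.*-inverseˡ (mkℚ (ℤ.+ suc k) 0 (Coprime.sym (Coprime.1-coprimeTo (suc k)))))

  ι*pow½≤recip : ∀ k d N → suc k ℕ.* d ℕ.≤ 2 ℕ.^ N → ι d * pow ½ N ≤ recip k
  ι*pow½≤recip k d N small = begin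
    ι d * P                              ≡⟨ ℚ.*-identityˡ (ι d * P) ⟨
    1ℚ * (ι d * P)                       ≡⟨ cong (_* (ι d * P)) (recip*ι k) ⟨
    recip k * ι (suc k) * (ι d * P)      ≡⟨ solve 4 (λ u x y p → u :* x :* (y :* p) := u :* (x :* y) :* p) refl
                                              (recip k) (ι (suc k)) (ι d) P ⟩
    recip k * (ι (suc k) * ι d) * P      ≡⟨ cong (λ z → recip k * z * P) (ι-* (suc k) d) ⟨
    recip k * ι (suc k ℕ.* d) * P        ≤⟨ ℚ.*-monoʳ-≤-nonNeg P {{pow-nonNegative ½ N}}
                                              (ℚ.*-monoˡ-≤-nonNeg (recip k) (ι-mono small)) ⟩
    recip k * ι (2 ℕ.^ N) * P            ≡⟨ cong (λ z → recip k * z * P) (ι-2^ N) ⟩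
    recip k * pow 2ℚ N * P               ≡⟨ ℚ.*-assoc (recip k) (pow 2ℚ N) P ⟩
    recip k * (pow 2ℚ N * P)             ≡⟨ cong (recip k *_) (pow-inverse N) ⟩
    recip k * 1ℚ                         ≡⟨ ℚ.*-identityʳ (recip k) ⟩
    recip k                              ∎
    where
    open ≤-Reasoning
    P = pow ½ N

  k⊥1+k : ∀ k → Coprime.Coprime k (suc k)
  k⊥1+k k = subst (Coprime.Coprime k) (ℕ.+-comm k 1)
    (Coprime.sym (Coprime.coprime-+ (Coprime.1-coprimeTo k)))

  -- The lowest-terms form of k/(k + 1), from which `RationalPower≤` reads off two integer powers;
  -- `1ℚ - recip k` does not reduce to it for a variable `k`.
  exponent : ℕ → ℚ
  exponent k = mkℚ (ℤ.+ k) k (k⊥1+k k)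

  1-recip : ∀ k → 1ℚ - recip k ≡ exponent k
  1-recip k = begin
    1ℚ - recip k                       ≡⟨ cong (_- recip k) total ⟨
    exponent k + recip k - recip k     ≡⟨ solve 2 (λ x y → x :+ y :- y := x) refl (exponent k) (recip k) ⟩
    exponent k                         ∎
    where
    open ≡-Reasoning
    cross : ∀ x → (x ℤ.* (ℤ.+ 1 ℤ.+ x) ℤ.+ ℤ.+ 1 ℤ.* (ℤ.+ 1 ℤ.+ x)) ℤ.* ℤ.+ 1 ≡ ℤ.+ 1 ℤ.* ((ℤ.+ 1 ℤ.+ x) ℤ.* (ℤ.+ 1 ℤ.+ x))
    cross = ℤ.solve-∀
    total : exponent k + recip k ≡ 1ℚ
    total = ℚ.toℚᵘ-injective (ℚᵘ.≃-trans (ℚ.toℚᵘ-homo-+ (exponent k) (recip k)) (ℚᵘ.*≡* (cross (ℤ.+ k))))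

  recip-antitone : ∀ {k m} → k ℕ.≤ m → recip m ≤ recip k
  recip-antitone k≤m = *≤* (ℤ.+≤+ (ℕ.*-monoʳ-≤ 1 (s≤s k≤m)))

  archimedean : ∀ δ → 0ℚ < δ → ∃ λ k → recip k < δ
  archimedean δ@(mkℚ (ℤ.+ zero) b c) (*<* (ℤ.+<+ ()))
  -- Here δ is at least 1/(b + 1), and the witness `suc b` gives 1/(b + 2).
  archimedean δ@(mkℚ (ℤ.+ suc a) b c) _ = suc b , *<* (ℤ.+<+ (begin-strict
    1 ℕ.* suc b                <⟨ ℕ.*-monoʳ-< 1 (ℕ.n<1+n (suc b)) ⟩
    1 ℕ.* suc (suc b)          ≤⟨ ℕ.*-monoˡ-≤ (suc (suc b)) (s≤s (z≤n {a})) ⟩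
    suc a ℕ.* suc (suc b)      ∎))
    where open ℕ.≤-Reasoning
  archimedean δ@(mkℚ ℤ.-[1+ a ] b c) (*<* ())

  -- An exponent tending to 1

  LargeHG : ∀ n → ℚ → Graph n → Set
  LargeHG n r G = RationalPower≤ n r (HG G)

  ℙ-large : ℕ → ℚ → ℚ
  ℙ-large n r = ℙ[G⟨ n , ½ ⟩∈ (λ G → rationalPower≤? n r (HG G)) ]

  -- One parameter controls both losses: the deficit in the exponent is 1/(k + 1), and the failure
  -- probability is at most that.
  eventually-likely : ∀ k n → threshold k ℕ.≤ n → 1ℚ - recip k ≤ ℙ-large n (1ℚ - recip k)
  eventually-likely k n large = begin
    1ℚ - recip k
      ≤⟨ ℚ.+-monoʳ-≤ 1ℚ (ℚ.neg-antimono-≤ (ι*pow½≤recip k d N (failure-bits π))) ⟩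
    1ℚ - ι d * pow ½ N
      ≤⟨ likely-if-book d N {{pages-nonZero π}} n (8^d*pages≤n π) (λ G → LargeHG n (1ℚ - recip k) G)
           (λ G → rationalPower≤? n (1ℚ - recip k) (HG G)) sufficient ⟩
    ℙ-large n (1ℚ - recip k) ∎
    where
    open ≤-Reasoning
    π = parameters k n large
    open Parameters π using (j) renaming (pages to N)
    d = suc j ℕ.+ suc j

    sufficient : ∀ G → Book G d N → LargeHG n (1ℚ - recip k) G
    sufficient G book = subst (λ r → LargeHG n r G) (sym (1-recip k)) (HG-large π G book)

  passed? : ∀ n k → Dec (threshold k ℕ.≤ n)
  passed? n k = threshold k ℕ.≤? n

  -- The largest exponent parameter whose bound already applies to n; it tends to
  -- infinity, which turns the bounds for fixed exponents into a single ε n → 0.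
  level : ℕ → ℕ
  level n = largestUpTo (passed? n) n

  -- The summand `suc k` keeps this candidate within the search range of `level`. A successor is
  -- taken because `largestUpTo-sat` asks for a positive candidate, 0 being the default of the
  -- search.
  module _ (k n : ℕ) (large : threshold (suc k) ℕ.+ suc k ℕ.≤ n) where

    threshold≤n : threshold (suc k) ℕ.≤ n
    threshold≤n = ℕ.≤-trans (ℕ.m≤m+n _ _) large

    suc-k≤n : suc k ℕ.≤ n
    suc-k≤n = ℕ.≤-trans (ℕ.m≤n+m _ (threshold (suc k))) large

    level-large : suc k ℕ.≤ level n
    level-large = largestUpTo-upper (passed? n) n (suc k) suc-k≤n threshold≤n

    level-passed : threshold (level n) ℕ.≤ n
    level-passed = largestUpTo-sat (passed? n) n (suc k) (s≤s z≤n) suc-k≤n threshold≤n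

    recip-level : recip (level n) ≤ recip k
    recip-level = recip-antitone (ℕ.≤-trans (ℕ.n≤1+n k) level-large)

  ℙ-large≤1 : ∀ n r → ℙ-large n r ≤ 1ℚ
  ℙ-large≤1 n r = 𝔼-edges-≤ n (λ e → 𝟙ℚ≤1 (does (rationalPower≤? n r (HG (toGraph e)))))

  ∣x-1∣≤ : ∀ {x u} → x ≤ 1ℚ → 1ℚ - u ≤ x → ∣ x - 1ℚ ∣ ≤ u
  ∣x-1∣≤ {x} {u} x≤1 1-u≤x = begin
    ∣ x - 1ℚ ∣       ≡⟨ cong ∣_∣ (solve 1 (λ x → x :- con 1ℚ := :- (con 1ℚ :- x)) refl x) ⟩
    ∣ - (1ℚ - x) ∣   ≡⟨ ℚ.∣-p∣≡∣p∣ (1ℚ - x) ⟩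
    ∣ 1ℚ - x ∣       ≡⟨ ℚ.0≤p⇒∣p∣≡p (ℚ.≤-trans (ℚ.≤-reflexive (sym (ℚ.+-inverseʳ x))) (ℚ.+-monoˡ-≤ (- x) x≤1)) ⟩
    1ℚ - x           ≤⟨ ℚ.+-monoʳ-≤ 1ℚ (ℚ.neg-antimono-≤ 1-u≤x) ⟩
    1ℚ - (1ℚ - u)    ≡⟨ solve 1 (λ u → con 1ℚ :- (con 1ℚ :- u) := u) refl u ⟩
    u                ∎
    where open ≤-Reasoning

open HatGuessing using (threshold)
open RandomGraphs

theorem2 : Σ (ℕ → ℚ) λ ε →
    (ε ⟶ 0ℚ) ×
    ((λ n → ℙ[G⟨ n , ½ ⟩∈ (λ G → rationalPower≤? n (1ℚ - ε n) (HG G)) ]) ⟶ 1ℚ)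
theorem2 = ε , ε⟶0 , ℙ⟶1
  where
  ε : ℕ → ℚ
  ε n = recip (level n)

  ε⟶0 : ε ⟶ 0ℚ
  ε⟶0 δ 0<δ = let (k , small) = archimedean δ 0<δ in
    threshold (suc k) ℕ.+ suc k , λ n large →
      ℚ.≤-<-trans (ℚ.≤-trans (ℚ.≤-reflexive (cong ∣_∣ (ℚ.+-identityʳ (ε n)))) (recip-level k n large)) small

  ℙ⟶1 : (λ n → ℙ-large n (1ℚ - ε n)) ⟶ 1ℚ
  -- The bound is applied with parameter `level n`, where its exponent is exactly 1 - ε n; only
  -- afterwards is `recip (level n)` compared with the fixed `recip k`.
  ℙ⟶1 δ 0<δ = let (k , small) = archimedean δ 0<δ in
    threshold (suc k) ℕ.+ suc k , λ n large →
      ℚ.≤-<-trans (ℚ.≤-trans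
        (∣x-1∣≤ (ℙ-large≤1 n (1ℚ - ε n)) (eventually-likely (level n) n (level-passed k n large)))
        (recip-level k n large)) small
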